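{- For every permutation $\alpha\in S_n$ of genus $1$ there exist a noncrossing partition $P$ of $\{1,\dots,n\}$ and a four-coloring $\gamma$ such that $\alpha=\Phi(P,\gamma)$.
   Context: Permutations are composed right to left; $\zeta_n=(1,2,\dots,n)$; $z(\pi)$ is the number of cycles of $\pi$; the genus $g(\alpha)$ of $\alpha\in S_n$ is defined by $n+1-2g(\alpha)=z(\alpha)+z(\alpha^{ -1}\zeta_n)$. A partition $P$ of $\{1,\dots,n\}$ is identified with the permutation $\beta_P$ whose cycles are its blocks written in increasing order; it is noncrossing if there are no $a<b<a'<b'$ with $a,a'$ in one block and $b,b'$ in another. A four-coloring $\gamma=(A,B,C,D)$ is given by integers $1\le i<j\le k<\ell\le n$: $A=\{\ell+1,\dots,n\}\cup\{1,\dots,i\}$, $B=\{i+1,\dots,j\}$, $C=\{j+1,\dots,k\}$, $D=\{k+1,\dots,\ell\}$. Define $\phi\in S_n$ by $\phi(x)=x$ on $A$, $\phi(x)=x+\ell-j$ on $B$, $\phi(x)=x+i+\ell-j-k$ on $C$, $\phi(x)=x+i-k$ on $D$, and $\Phi(P,\gamma)=\phi\beta_P\phi^{ -1}$. -}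

module Defs where

open import Data.Nat using (ℕ; zero; suc; _+_; _*_; _∸_; _≤_; _<_; _≤ᵇ_; _<ᵇ_; _≡ᵇ_; _<?_)
open import Data.Bool using (Bool; true; false; if_then_else_; _∧_)
open import Data.Fin using (Fin; toℕ; fromℕ<)
open import Data.Fin.Permutation using (Permutation′; _⟨$⟩ʳ_; _⟨$⟩ˡ_)
open import Data.List using (List; map; upTo)
open import Data.Nat.ListAction using (sum)
open import Data.Bool.ListAction using (and)
open import Data.Maybe using (Maybe; just; nothing; fromMaybe)
open import Relation.Nullary using (yes; no)
open import Relation.Binary.PropositionalEquality using (_≡_)

-- Convention: everything is done on ℕ, with the ground set {1,…,n}.
-- Values of functions ℕ → ℕ outside {1,…,n} are irrelevant.

-- A permutation α ∈ S_n is an element of Permutation′ n (a bijection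
-- Fin n ↔ Fin n); the label x ∈ {1..n} corresponds to the Fin index x-1.
-- ⟦ α ⟧ is α as a map on {1,…,n} (identity outside).
⟦_⟧ : {n : ℕ} → Permutation′ n → ℕ → ℕ
⟦_⟧ {n} α x with x ∸ 1 <? n
... | yes p = suc (toℕ (α ⟨$⟩ʳ fromℕ< p))
... | no _  = x

⟦_⟧⁻¹ : {n : ℕ} → Permutation′ n → ℕ → ℕ
⟦_⟧⁻¹ {n} α x with x ∸ 1 <? n
... | yes p = suc (toℕ (α ⟨$⟩ˡ fromℕ< p))
... | no _  = x

ζ : ℕ → ℕ → ℕ
ζ n x = if x <ᵇ n then suc x else 1

infixr 9 _∘′_
_∘′_ : (ℕ → ℕ) → (ℕ → ℕ) → ℕ → ℕ
(f ∘′ g) x = f (g x)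

iter : (ℕ → ℕ) → ℕ → ℕ → ℕ
iter f zero    x = x
iter f (suc k) x = f (iter f k x)

[1‥_] : ℕ → List ℕ
[1‥ n ] = map suc (upTo n)

-- x is the least element of its cycle under f (f a permutation of {1..n});
-- a cycle has length ≤ n so it suffices to look at f^k x for k < n.
isCycleMin : ℕ → (ℕ → ℕ) → ℕ → Bool
isCycleMin n f x = and (map (λ k → x ≤ᵇ iter f k x) (upTo n))

-- z(f): number of cycles of a permutation f of {1,…,n}
-- (= number of cycles, each counted once via its least element)
z : ℕ → (ℕ → ℕ) → ℕ
z n f = sum (map (λ x → if isCycleMin n f x then 1 else 0) [1‥ n ])

HasGenus : (n : ℕ) → Permutation′ n → ℕ → Set
HasGenus n α g = n + 1 ≡ 2 * g + (z n ⟦ α ⟧ + z n (⟦ α ⟧⁻¹ ∘′ ζ n))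

-- Partitions of {1,…,n}: given by a block-labelling  b : ℕ → ℕ
-- (x, y ∈ {1..n} lie in the same block iff b x ≡ b y).

NonCrossing : ℕ → (ℕ → ℕ) → Set
NonCrossing n b =
  ∀ a c a′ c′ → 1 ≤ a → a < c → c < a′ → a′ < c′ → c′ ≤ n →
  b a ≡ b a′ → b c ≡ b c′ → b a ≡ b c

firstFrom : (ℕ → Bool) → ℕ → ℕ → Maybe ℕ
firstFrom p a zero      = nothing
firstFrom p a (suc len) = if p a then just a else firstFrom p (suc a) len

-- β_P: the permutation whose cycles are the blocks in increasing order:
-- x ↦ next larger element of its block, or the block minimum if x is
-- the block maximum.
β : ℕ → (ℕ → ℕ) → ℕ → ℕ
β n b x =
  fromMaybe (fromMaybe x (firstFrom same 1 n)) (firstFrom same (suc x) (n ∸ x))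
  where
  same : ℕ → Bool
  same y = b y ≡ᵇ b x

record FourColoring (n : ℕ) : Set where
  constructor fc
  field
    i j k ℓ : ℕ
    1≤i : 1 ≤ i
    i<j : i < j
    j≤k : j ≤ k
    k<ℓ : k < ℓ
    ℓ≤n : ℓ ≤ n

-- φ: identity on A, x+ℓ-j on B, x+i+ℓ-j-k on C, x+i-k on D
-- (truncated subtraction is exact on the relevant ranges)
φ : {n : ℕ} → FourColoring n → ℕ → ℕ
φ γ x =
  if x ≤ᵇ i then x
  else if ℓ <ᵇ x then x
  else if x ≤ᵇ j then x + ℓ ∸ j
  else if x ≤ᵇ k then x + i + ℓ ∸ (j + k)
  else x + i ∸ k
  where open FourColoring γ

-- φ⁻¹: φ maps D onto [i+1, i+ℓ-k], C onto [i+ℓ-k+1, i+ℓ-j],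
-- B onto [i+ℓ-j+1, ℓ], and fixes A.
φ⁻¹ : {n : ℕ} → FourColoring n → ℕ → ℕ
φ⁻¹ γ y =
  if y ≤ᵇ i then y
  else if ℓ <ᵇ y then y
  else if y ≤ᵇ i + ℓ ∸ k then y + k ∸ i
  else if y ≤ᵇ i + ℓ ∸ j then y + j + k ∸ (i + ℓ)
  else y + j ∸ ℓ
  where open FourColoring γ

Φ : (n : ℕ) → (ℕ → ℕ) → FourColoring n → ℕ → ℕ
Φ n b γ = φ γ ∘′ β n b ∘′ φ⁻¹ γ

{-# OPTIONS --safe #-}
module Submission where

open import Defs
open import Data.Nat
  using (ℕ; zero; suc; _+_; _∸_; _≤_; _<_; z≤n; s≤s; z<s; s<s; _≤ᵇ_; _<ᵇ_; _≡ᵇ_; _≟_; _≤?_; _<?_)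
open import Data.Nat.Properties
open import Data.Nat.Induction using (<-rec)
open import Data.Nat.Tactic.RingSolver using (solve-∀)
open import Data.Nat.ListAction using (sum)
open import Data.Bool using (Bool; true; false; T; if_then_else_)
open import Data.Bool.Properties using (T-≡)
open import Data.Bool.ListAction using (and)
open import Data.Fin using (toℕ; fromℕ<)
open import Data.Fin.Permutation using (Permutation′; _⟨$⟩ʳ_; _⟨$⟩ˡ_; inverseˡ; inverseʳ)
open import Data.Fin.Properties using (pigeonhole; toℕ<n; fromℕ<-injective; toℕ-fromℕ<; fromℕ<-toℕ)
open import Data.List using (map; applyUpTo; upTo)
open import Data.List.Properties using (map-cong)
open import Data.Maybe using (just; nothing; fromMaybe)
open import Data.Product using (Σ; ∃-syntax; _×_; _,_; proj₁; proj₂)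
open import Data.Sum using (_⊎_; inj₁; inj₂)
open import Function using (_∘_; id; case_of_; Equivalence)
open import Relation.Binary using (tri<; tri≈; tri>)
open import Relation.Binary.PropositionalEquality
  using (_≡_; _≢_; refl; sym; trans; cong; cong₂; subst; subst₂; module ≡-Reasoning)
open import Relation.Nullary using (¬_; Dec; yes; no; contradiction)
open import Relation.Nullary.Decidable using (_×-dec_; map′; ¬?; decidable-stable)

-- Let g = α⁻¹ζ. If the cycles of g were increasing and pairwise noncrossing, then α would have
-- genus 0; so there are a < b ≤ c < d such that multiplying g by τ = (a c)(b d) splits cycles twice.
-- The product ζτ is again an n-cycle: cutting the circle after a, b, c, d and reversing the order of the
-- arcs gives a four-coloring with ζτ = φζφ⁻¹. Since α (gτ) = ζτ and gτ has two cycles more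
-- than g, the conjugate φ⁻¹αφ has genus 0. If its cycles were not noncrossing and increasing, the same
-- splitting would produce a factorisation of an n-cycle of negative genus.

-- Both ways of failing to be a noncrossing partition have the same witness. Two cycles that cross
-- supply `a < b < c < d`. A cycle that is not increasing supplies three labels visited in the wrong
-- order: the degenerate case `b = c`, which is the four-coloring with `j = k` and empty class C.
-- What matters in either case is only that τ splits twice, and this is what `Crossing` records.
--
-- That an uncrossed g forces genus 0 is an induction on n - z(g), in which α and g change together
-- while their product stays ζ. An excedance x < g x is bypassed by putting a transposition into g.
-- If x and g x lie in different cycles of α, the matching transposition merges these two cycles, so
-- z(α) + z(g) does not change; if they lie in the same cycle, a crossing of g is already present.
-- The process ends with g the identity and α = ζ, where the sum is n + 1.

variable
  n : ℕ

-- Permutations of {1,...,n} as bijections of ℕ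

record In (n x : ℕ) : Set where
  constructor _,_
  field
    lower : 1 ≤ x
    upper : x ≤ n

in? : ∀ n x → Dec (In n x)
in? n x = map′ (λ (l , u) → l , u) (λ (l , u) → l , u) (1 ≤? x ×-dec x ≤? n)

-- S_n is realised by bijections of ℕ that are the identity off {1,…,n}; this keeps
-- orbits, products and transpositions free of range side conditions.
record Perm (n : ℕ) : Set where
  infixr 20 _·_
  field
    _·_       : ℕ → ℕ
    inv       : ℕ → ℕ
    inv-left  : ∀ x → inv (_·_ x) ≡ x
    inv-right : ∀ x → _·_ (inv x) ≡ x
    fix       : ∀ x → ¬ In n x → _·_ x ≡ x

  injective : ∀ {x y} → _·_ x ≡ _·_ y → x ≡ y
  injective {x} {y} e = trans (sym (inv-left x)) (trans (cong inv e) (inv-left y))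

  ·-In : ∀ {x} → In n x → In n (_·_ x)
  ·-In {x} i with in? n (_·_ x)
  ... | yes j = j
  ... | no ¬j = contradiction (subst (In n) (sym (injective (fix (_·_ x) ¬j))) i) ¬j

open Perm public

inverse : Perm n → Perm n
inverse f = record
  { _·_ = inv f
  ; inv = f ·_
  ; inv-left = inv-right f
  ; inv-right = inv-left f
  ; fix = λ x ¬i → trans (cong (inv f) (sym (fix f x ¬i))) (inv-left f x) }

infixr 9 _⊙_
_⊙_ : Perm n → Perm n → Perm n
f ⊙ g = record
  { _·_ = λ x → f · g · x
  ; inv = λ x → inv g (inv f x)
  ; inv-left = λ x → trans (cong (inv g) (inv-left f (g · x))) (inv-left g x)
  ; inv-right = λ x → trans (cong (f ·_) (inv-right g (inv f x))) (inv-right f x)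
  ; fix = λ x ¬i → trans (cong (f ·_) (fix g x ¬i)) (fix f x ¬i) }

-- Transpositions

swap : ℕ → ℕ → ℕ → ℕ
swap a b x with x ≟ a
... | yes _ = b
... | no _ with x ≟ b
...   | yes _ = a
...   | no _  = x

-- The image is an index, so matching on `swapView` next to `swap a b x` reveals the value together
-- with its reason.
data Swap (a b x : ℕ) : ℕ → Set where
  left  : x ≡ a → Swap a b x b
  right : x ≡ b → Swap a b x a
  other : x ≢ a → x ≢ b → Swap a b x x

swapView : ∀ a b x → Swap a b x (swap a b x)
swapView a b x with x ≟ a
... | yes e = left e
... | no ¬e with x ≟ b
...   | yes e = right e
...   | no ¬f  = other ¬e ¬f

swap-left : ∀ a b → swap a b a ≡ b
swap-left a b with swap a b a | swapView a b a
... | _ | left _ = refl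
... | _ | right refl = refl
... | _ | other ne _ = contradiction refl ne

swap-right : ∀ a b → swap a b b ≡ a
swap-right a b with swap a b b | swapView a b b
... | _ | left refl = refl
... | _ | right _ = refl
... | _ | other _ ne = contradiction refl ne

swap-other : ∀ {a b x} → x ≢ a → x ≢ b → swap a b x ≡ x
swap-other {a} {b} {x} p q with swap a b x | swapView a b x
... | _ | left e = contradiction e p
... | _ | right e = contradiction e q
... | _ | other _ _ = refl

swap-involutive : ∀ a b x → swap a b (swap a b x) ≡ x
swap-involutive a b x with swap a b x | swapView a b x
... | _ | left refl = swap-right a b
... | _ | right refl = swap-left a b
... | _ | other p q = swap-other p q

-- The conjugation rule f (a b) f⁻¹ = (f a, f b) with the inverse cleared; it carries a
-- transposition past `f` in a product.
swap-equivariant : ∀ (f : Perm n) a b x → f · swap a b x ≡ swap (f · a) (f · b) (f · x)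
swap-equivariant f a b x with swap a b x | swapView a b x
... | _ | left refl = sym (swap-left (f · a) (f · b))
... | _ | right refl = sym (swap-right (f · a) (f · b))
... | _ | other p q = sym (swap-other (p ∘ injective f) (q ∘ injective f))

transposition : ∀ {a b} → In n a → In n b → Perm n
transposition {n} {a} {b} i j = record
  { _·_ = swap a b
  ; inv = swap a b
  ; inv-left = swap-involutive a b
  ; inv-right = swap-involutive a b
  ; fix = λ x ¬k → swap-other (λ { refl → ¬k i }) (λ { refl → ¬k j }) }

-- Orbits

infix 4 _⊢_~_
-- Only forward steps generate the relation, so a set closed under `f` contains the whole orbit of
-- each of its members; symmetry comes from finiteness of the cycles, in `~-sym`.
data _⊢_~_ {n} (f : Perm n) (x : ℕ) : ℕ → Set where
  here : f ⊢ x ~ x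
  next : ∀ {y} → f ⊢ x ~ y → f ⊢ x ~ f · y

module _ {n} {f : Perm n} where

  edge : ∀ {x y} → f · x ≡ y → f ⊢ x ~ y
  edge refl = next here

  ~-trans : ∀ {x y u} → f ⊢ x ~ y → f ⊢ y ~ u → f ⊢ x ~ u
  ~-trans p here = p
  ~-trans p (next q) = next (~-trans p q)

  ~-preserves : (S : ℕ → Set) → (∀ u → S u → S (f · u)) → ∀ {x y} → f ⊢ x ~ y → S x → S y
  ~-preserves S h here s = s
  ~-preserves S h (next p) s = h _ (~-preserves S h p s)

  ~-iter : ∀ k x → f ⊢ x ~ iter (f ·_) k x
  ~-iter zero x = here
  ~-iter (suc k) x = next (~-iter k x)

  ~-fixed : ∀ {x y} → f · x ≡ x → f ⊢ x ~ y → y ≡ x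
  ~-fixed {x} e p = ~-preserves (_≡ x) (λ { u refl → e }) p refl

  ~-In : ∀ {x y} → In n x → f ⊢ x ~ y → In n y
  ~-In i p = ~-preserves (In n) (λ _ → ·-In f) p i

  ~-In-≢ : ∀ {x y} → f ⊢ x ~ y → x ≢ y → In n x
  ~-In-≢ {x} p x≢y with in? n x
  ... | yes i = i
  ... | no ¬i = contradiction (sym (~-fixed (fix f x ¬i) p)) x≢y

  iter-In : ∀ k {x} → In n x → In n (iter (f ·_) k x)
  iter-In k {x} i = ~-In i (~-iter k x)

  iter-suc : ∀ k x → iter (f ·_) (suc k) x ≡ iter (f ·_) k (f · x)
  iter-suc zero x = refl
  iter-suc (suc k) x = cong (f ·_) (iter-suc k x)

  iter-+ : ∀ k l x → iter (f ·_) (k + l) x ≡ iter (f ·_) k (iter (f ·_) l x)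
  iter-+ zero l x = refl
  iter-+ (suc k) l x = cong (f ·_) (iter-+ k l x)

  iter-injective : ∀ k {x y} → iter (f ·_) k x ≡ iter (f ·_) k y → x ≡ y
  iter-injective zero e = e
  iter-injective (suc k) e = iter-injective k (injective f e)

  -- Two of the iterates with exponents 0 to n coincide, and injectivity cancels the smaller
  -- exponent. A label out of range is fixed, hence the witness 0.
  period : ∀ x → ∃[ p ] iter (f ·_) (suc p) x ≡ x × (In n x → suc p ≤ n)
  period x with in? n x
  ... | no ¬i = 0 , fix f x ¬i , (λ i → contradiction i ¬i)
  ... | yes i = from (pigeonhole (n<1+n n) (λ k → fromℕ< (below (toℕ k))))
    where
    pos : ∀ k → ∃[ m ] iter (f ·_) k x ≡ suc m
    pos k with iter (f ·_) k x | iter-In k i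
    ... | suc m | _ = m , refl
    below : ∀ k → proj₁ (pos k) < n
    below k = subst (_≤ n) (proj₂ (pos k)) (In.upper (iter-In k i))
    from : (∃[ k ] ∃[ l ] toℕ k < toℕ {suc n} l × fromℕ< (below (toℕ k)) ≡ fromℕ< (below (toℕ l))) → _
    from (k , l , k<l , e) with m≤n⇒∃[o]m+o≡n k<l
    ... | p , k+p≡l = p , period≡ , (λ _ → bound)
      where
      e′ : iter (f ·_) (toℕ k) x ≡ iter (f ·_) (toℕ l) x
      e′ = trans (proj₂ (pos (toℕ k)))
             (trans (cong suc (fromℕ<-injective _ _ (below (toℕ k)) (below (toℕ l)) e))
               (sym (proj₂ (pos (toℕ l)))))
      l≡ : toℕ l ≡ toℕ k + suc p
      l≡ = trans (sym k+p≡l) (sym (+-suc (toℕ k) p))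
      period≡ : iter (f ·_) (suc p) x ≡ x
      period≡ = sym (iter-injective (toℕ k)
        (trans e′ (trans (cong (λ m → iter (f ·_) m x) l≡) (iter-+ (toℕ k) (suc p) x))))
      bound : suc p ≤ n
      bound = ≤-trans (m≤n+m (suc p) (toℕ k)) (≤-trans (≤-reflexive (sym l≡)) (≤-pred (toℕ<n l)))

  ~-sym : ∀ {x y} → f ⊢ x ~ y → f ⊢ y ~ x
  ~-sym here = here
  ~-sym {x} (next {y} p) with period y
  ... | q , e , _ = ~-trans (subst (f ⊢ f · y ~_) (trans (sym (iter-suc q y)) e) (~-iter q (f · y))) (~-sym p)

  -- The bound `k < suc n` holds for every label and makes orbits searchable without a range
  -- condition; `k < n` is the range of exponents that `isCycleMin` inspects.
  ~-bounded : ∀ {x y} → f ⊢ x ~ y → ∃[ k ] k < suc n × (In n x → k < n) × iter (f ·_) k x ≡ y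
  ~-bounded {x} p with period x
  ... | q , e , q<n = from (reduced p)
    where
    reduced : ∀ {y} → f ⊢ x ~ y → ∃[ k ] k < suc q × iter (f ·_) k x ≡ y
    reduced here = 0 , z<s , refl
    reduced (next p) with reduced p
    ... | k , k<q , refl with m≤n⇒m<n∨m≡n k<q
    ...   | inj₁ lt = suc k , lt , refl
    ...   | inj₂ refl = 0 , z<s , sym e
    from : (∃[ k ] k < suc q × iter (f ·_) k x ≡ _) → _
    from (k , k<q , e′) with in? n x
    ... | yes i = k , m<n⇒m<1+n (≤-trans k<q (q<n i)) , (λ _ → ≤-trans k<q (q<n i)) , e′
    ... | no ¬i = 0 , z<s , (λ i → contradiction i ¬i)
                , sym (~-fixed (fix f x ¬i) p)

  ~-dec : ∀ x y → Dec (f ⊢ x ~ y)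
  ~-dec x y = map′ (λ { (k , _ , refl) → ~-iter k x })
                   (λ p → let k , lt , _ , e = ~-bounded p in k , lt , e)
                   (anyUpTo? (λ k → iter (f ·_) k x ≟ y) (suc n))

  Least : ℕ → Set
  Least x = ∀ {y} → f ⊢ x ~ y → x ≤ y

  least : ∀ x → ∃[ m ] f ⊢ x ~ m × Least m
  least = <-rec _ step
    where
    step : ∀ x → (∀ {y} → y < x → ∃[ m ] f ⊢ y ~ m × Least m) → ∃[ m ] f ⊢ x ~ m × Least m
    step x rec with anyUpTo? (λ k → iter (f ·_) k x <? x) (suc n)
    ... | yes (k , _ , lt) = let m , p , l = rec lt in m , ~-trans (~-iter k x) p , l
    ... | no none = x , here , λ p → let k , lt , _ , e = ~-bounded p in
                      subst (x ≤_) e (≮⇒≥ (λ lt′ → none (k , lt , lt′)))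

  least-unique : ∀ {x y} → Least x → Least y → f ⊢ x ~ y → x ≡ y
  least-unique l m p = ≤-antisym (l p) (m (~-sym p))

-- Counting

count : (ℕ → Bool) → ℕ → ℕ
count p zero = 0
count p (suc n) = (if p 0 then 1 else 0) + count (p ∘ suc) n

sum-indicator : ∀ (p : ℕ → Bool) g n →
  sum (map (λ x → if p x then 1 else 0) (map suc (applyUpTo g n))) ≡ count (p ∘ suc ∘ g) n
sum-indicator p g zero = refl
sum-indicator p g (suc n) = cong (_ +_) (sum-indicator p (g ∘ suc) n)

count-cong : ∀ {p q} n → (∀ u → u < n → p u ≡ q u) → count p n ≡ count q n
count-cong zero e = refl
count-cong (suc n) e =
  cong₂ (λ b c → (if b then 1 else 0) + c) (e 0 z<s) (count-cong n (λ u lt → e (suc u) (s<s lt)))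

count-remove : ∀ {p q w} n → w < n → p w ≡ true → q w ≡ false →
  (∀ u → u < n → u ≢ w → p u ≡ q u) → count p n ≡ suc (count q n)
count-remove {w = zero} (suc n) _ pw qw e rewrite pw | qw =
  cong suc (count-cong n (λ u lt → e (suc u) (s<s lt) λ ()))
count-remove {p} {q} {suc w} (suc n) (s<s lt) pw qw e
  rewrite e 0 z<s (λ ())
        | count-remove {p ∘ suc} {q ∘ suc} n lt pw qw (λ u lt′ ne → e (suc u) (s<s lt′) (ne ∘ suc-injective))
  = +-suc _ _

count-≤ : ∀ p n → count p n ≤ n
count-≤ p zero = z≤n
count-≤ p (suc n) with p 0
... | true = s≤s (count-≤ (p ∘ suc) n)
... | false = m≤n⇒m≤1+n (count-≤ (p ∘ suc) n)

count-true : ∀ {p} n → (∀ u → u < n → p u ≡ true) → count p n ≡ n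
count-true zero e = refl
count-true (suc n) e rewrite e 0 z<s = cong suc (count-true n (λ u lt → e (suc u) (s<s lt)))

count-false : ∀ n → count (λ _ → false) n ≡ 0
count-false zero = refl
count-false (suc n) = count-false n

without : ℕ → (ℕ → Bool) → ℕ → Bool
without w p u with u ≟ w
... | yes _ = false
... | no _ = p u

without-self : ∀ w p → without w p w ≡ false
without-self w p with w ≟ w
... | yes _ = refl
... | no ne = contradiction refl ne

without-other : ∀ {w p u} → u ≢ w → without w p u ≡ p u
without-other {w} {u = u} ne with u ≟ w
... | yes e = contradiction e ne
... | no _ = refl

-- Once 0 has been sent to `h 0`, that target is struck from `q`; injectivity keeps the images of
-- the remaining arguments away from it.
count-injection : ∀ {p} q (h : ℕ → ℕ) m n →
  (∀ u → u < m → p u ≡ true → h u < n × q (h u) ≡ true) →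
  (∀ u v → u < m → v < m → p u ≡ true → p v ≡ true → h u ≡ h v → u ≡ v) →
  count p m ≤ count q n
count-injection q h zero n _ _ = z≤n
count-injection {p} q h (suc m) n into inj with p 0 in p0
... | false = count-injection q (h ∘ suc) m n (λ u lt → into (suc u) (s<s lt))
                (λ u v lu lv pu pv e → suc-injective (inj _ _ (s<s lu) (s<s lv) pu pv e))
... | true = ≤-trans
  (s≤s (count-injection (without (h 0) q) (h ∘ suc) m n
    (λ u lt pu → proj₁ (into (suc u) (s<s lt) pu) ,
      trans (without-other (λ e → 1+n≢0 (inj _ _ (s<s lt) z<s pu p0 e))) (proj₂ (into (suc u) (s<s lt) pu)))
    (λ u v lu lv pu pv e → suc-injective (inj _ _ (s<s lu) (s<s lv) pu pv e))))
  (≤-reflexive (sym (count-remove {q} n (proj₁ (into 0 z<s p0)) (proj₂ (into 0 z<s p0))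
    (without-self (h 0) q) (λ u _ ne → sym (without-other ne)))))

-- The number of cycles

T⇒true : ∀ {b} → T b → b ≡ true
T⇒true = Equivalence.to T-≡

true⇒T : ∀ {b} → b ≡ true → T b
true⇒T = Equivalence.from T-≡

true⇔true : ∀ {a b} → (a ≡ true → b ≡ true) → (b ≡ true → a ≡ true) → a ≡ b
true⇔true {true} f g = sym (f refl)
true⇔true {false} {true} f g = g refl
true⇔true {false} {false} f g = refl

≢true : ∀ {b} → b ≢ true → b ≡ false
≢true {true} ne = contradiction refl ne
≢true {false} _ = refl

and-true⁺ : ∀ (p : ℕ → Bool) g n → (∀ k → k < n → p (g k) ≡ true) → and (map p (applyUpTo g n)) ≡ true
and-true⁺ p g zero h = refl
and-true⁺ p g (suc n) h rewrite h 0 z<s = and-true⁺ p (g ∘ suc) n (λ k lt → h (suc k) (s<s lt))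

and-true⁻ : ∀ (p : ℕ → Bool) g n → and (map p (applyUpTo g n)) ≡ true → ∀ k → k < n → p (g k) ≡ true
and-true⁻ p g (suc n) e k lt with p (g 0) in e₀
and-true⁻ p g (suc n) e zero lt | true = e₀
and-true⁻ p g (suc n) e (suc k) (s<s lt) | true = and-true⁻ p (g ∘ suc) n e k lt

isLeast : Perm n → ℕ → Bool
isLeast {n} f = isCycleMin n (f ·_)

cycles : Perm n → ℕ
cycles {n} f = z n (f ·_)

cycles≡count : (f : Perm n) → cycles f ≡ count (isLeast f ∘ suc) n
cycles≡count {n} f = sum-indicator (isLeast f) id n

Least⇒isLeast : (f : Perm n) → ∀ {x} → Least {f = f} x → isLeast f x ≡ true
Least⇒isLeast {n} f {x} l =
  and-true⁺ (λ k → x ≤ᵇ iter (f ·_) k x) id n (λ k _ → T⇒true (≤⇒≤ᵇ (l (~-iter k x))))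

isLeast⇒Least : (f : Perm n) → ∀ {x} → In n x → isLeast f x ≡ true → Least {f = f} x
isLeast⇒Least {n} f {x} i e p with ~-bounded p
... | k , _ , lt , refl = ≤ᵇ⇒≤ _ _ (true⇒T (and-true⁻ (λ k → x ≤ᵇ iter (f ·_) k x) id n e k (lt i)))

cycles-≤ : (f : Perm n) → cycles f ≤ n
cycles-≤ {n} f = subst (_≤ n) (sym (cycles≡count f)) (count-≤ _ n)

suc-In : ∀ {u} → u < n → In n (suc u)
suc-In lt = s≤s z≤n , lt

In-suc : ∀ {x} → In n x → ∃[ u ] u < n × x ≡ suc u
In-suc {x = suc u} (_ , lt) = u , lt , refl

isLeast-cong : (f g : Perm n) → ∀ {x} → In n x → (Least {f = f} x → Least {f = g} x) →
  (Least {f = g} x → Least {f = f} x) → isLeast f x ≡ isLeast g x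
isLeast-cong f g i h k = true⇔true
  (λ e → Least⇒isLeast g (h (isLeast⇒Least f i e)))
  (λ e → Least⇒isLeast f (k (isLeast⇒Least g i e)))

~-cong : {f g : Perm n} → (∀ x → f · x ≡ g · x) → ∀ {x y} → f ⊢ x ~ y → g ⊢ x ~ y
~-cong e here = here
~-cong {g = g} e (next {y} p) = subst (g ⊢ _ ~_) (sym (e y)) (next (~-cong e p))

cycles-cong : (f g : Perm n) → (∀ x → f · x ≡ g · x) → cycles f ≡ cycles g
cycles-cong {n} f g e = trans (cycles≡count f) (trans
  (count-cong n (λ u lt → isLeast-cong f g (suc-In lt)
    (λ l p → l (~-cong (sym ∘ e) p)) (λ l p → l (~-cong e p))))
  (sym (cycles≡count g)))

-- `h` carries cycles of `f` to cycles of `g`, but need not carry least elements to least elements.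
-- The injection therefore sends a least element to the minimum of the `g`-cycle of its image.
-- Counting is over `u` with label `suc u`, hence the `∸ 1`.
cycles-≤-conjugate : (f g h : Perm n) → (∀ x → h · f · x ≡ g · h · x) → cycles f ≤ cycles g
cycles-≤-conjugate {n} f g h e =
  subst₂ _≤_ (sym (cycles≡count f)) (sym (cycles≡count g))
    (count-injection (isLeast g ∘ suc) (λ u → rep (suc u) ∸ 1) n n into inj)
  where
  rep : ℕ → ℕ
  rep x = proj₁ (least {f = g} (h · x))
  pull : ∀ {x y} → g ⊢ h · x ~ y → f ⊢ x ~ inv h y
  pull {x} here = subst (f ⊢ x ~_) (sym (inv-left h x)) here
  pull {x} (next {y} p) = subst (f ⊢ x ~_)
    (sym (trans (cong (λ v → inv h (g · v)) (sym (inv-right h y))) (trans (cong (inv h) (sym (e (inv h y)))) (inv-left h _))))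
    (next (pull p))
  to-rep : ∀ x → g ⊢ h · x ~ rep x
  to-rep x = proj₁ (proj₂ (least (h · x)))
  In-pred : ∀ {x} → In n x → x ≡ suc (x ∸ 1)
  In-pred {suc x} _ = refl
  rep-In : ∀ {x} → In n x → In n (rep x)
  rep-In i = ~-In (·-In h i) (to-rep _)
  into : ∀ u → u < n → isLeast f (suc u) ≡ true → rep (suc u) ∸ 1 < n × isLeast g (suc (rep (suc u) ∸ 1)) ≡ true
  into u lt _ = subst (_≤ n) eq (In.upper i)
              , subst (λ v → isLeast g v ≡ true) eq (Least⇒isLeast g (proj₂ (proj₂ (least (h · suc u)))))
    where
    i = rep-In (suc-In lt)
    eq = In-pred i
  inj : ∀ u v → u < n → v < n → isLeast f (suc u) ≡ true → isLeast f (suc v) ≡ true →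
    rep (suc u) ∸ 1 ≡ rep (suc v) ∸ 1 → u ≡ v
  inj u v u<n v<n lu lv eq = suc-injective (least-unique
    (isLeast⇒Least f (suc-In u<n) lu) (isLeast⇒Least f (suc-In v<n) lv)
    (subst (f ⊢ suc u ~_) (inv-left h (suc v)) (pull joined)))
    where
    rep≡ : rep (suc u) ≡ rep (suc v)
    rep≡ = trans (In-pred (rep-In (suc-In u<n))) (trans (cong suc eq) (sym (In-pred (rep-In (suc-In v<n)))))
    joined : g ⊢ h · suc u ~ h · suc v
    joined = ~-trans (subst (g ⊢ h · suc u ~_) rep≡ (to-rep (suc u))) (~-sym (to-rep (suc v)))

cycles-conjugate : (f g h : Perm n) → (∀ x → h · f · x ≡ g · h · x) → cycles f ≡ cycles g
cycles-conjugate f g h e = ≤-antisym (cycles-≤-conjugate f g h e)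
  (cycles-≤-conjugate g f (inverse h) λ x →
    injective h (trans (inv-right h _) (trans (cong (g ·_) (sym (inv-right h x))) (sym (e (inv h x))))))

-- Multiplying by a transposition

-- The orbit relation of `f` after gluing the orbits of `x` and `y`, in a normal form where a path
-- uses the glue at most once.
Merged : Perm n → ℕ → ℕ → ℕ → ℕ → Set
Merged f x y u v = f ⊢ u ~ v ⊎ f ⊢ u ~ x × f ⊢ y ~ v ⊎ f ⊢ u ~ y × f ⊢ x ~ v

Merged-sym : (f : Perm n) → ∀ {x y u v} → Merged f x y u v → Merged f y x u v
Merged-sym f (inj₁ p) = inj₁ p
Merged-sym f (inj₂ (inj₁ p)) = inj₂ (inj₂ p)
Merged-sym f (inj₂ (inj₂ p)) = inj₂ (inj₁ p)

cycles-merge-< : (f f′ : Perm n) {x y mx my : ℕ} → In n y →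
  (∀ {u v} → f ⊢ u ~ v → f′ ⊢ u ~ v) → f′ ⊢ x ~ y → (∀ {u v} → f′ ⊢ u ~ v → Merged f x y u v) →
  f ⊢ x ~ mx → Least {f = f} mx → f ⊢ y ~ my → Least {f = f} my → mx < my →
  cycles f ≡ suc (cycles f′)
cycles-merge-< {n} f f′ {x} {y} {mx} {my} iy sub x~y split x~mx lx y~my ly mx<my
  with In-suc (~-In iy y~my)
... | w , w<n , refl = trans (cycles≡count f) (trans
  (count-remove n w<n (Least⇒isLeast f ly) (≢true not-least) agree)
  (cong suc (sym (cycles≡count f′))))
  where
  not-least : isLeast f′ my ≢ true
  not-least e = <⇒≱ mx<my (isLeast⇒Least f′ (suc-In w<n) e
    (~-trans (~-sym (sub y~my)) (~-trans (~-sym x~y) (sub x~mx))))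
  agree : ∀ u → u < n → u ≢ w → isLeast f (suc u) ≡ isLeast f′ (suc u)
  agree u u<n u≢w = isLeast-cong f f′ (suc-In u<n) grow (λ l p → l (sub p))
    where
    grow : Least {f = f} (suc u) → Least {f = f′} (suc u)
    grow l p with split p
    ... | inj₁ q = l q
    ... | inj₂ (inj₁ (u~x , y~v)) = ≤-trans (≤-reflexive (least-unique l lx (~-trans u~x x~mx)))
            (≤-trans (<⇒≤ mx<my) (ly (~-trans (~-sym y~my) y~v)))
    ... | inj₂ (inj₂ (u~y , _)) = contradiction (suc-injective (least-unique l ly (~-trans u~y y~my))) u≢w

cycles-merge : (f f′ : Perm n) {x y : ℕ} → In n x → In n y →
  (∀ {u v} → f ⊢ u ~ v → f′ ⊢ u ~ v) → f′ ⊢ x ~ y → (∀ {u v} → f′ ⊢ u ~ v → Merged f x y u v) →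
  ¬ f ⊢ x ~ y → cycles f ≡ suc (cycles f′)
cycles-merge f f′ {x} {y} ix iy sub x~y split x≁y with least {f = f} x | least {f = f} y
... | mx , px , lx | my , py , ly with <-cmp mx my
...   | tri< lt _ _ = cycles-merge-< f f′ iy sub x~y split px lx py ly lt
...   | tri≈ _ refl _ = contradiction (~-trans px (~-sym py)) x≁y
...   | tri> _ _ gt = cycles-merge-< f f′ ix sub (~-sym x~y) (Merged-sym f ∘ split) py ly px lx gt

module _ {n x y} (ix : In n x) (iy : In n y) (f : Perm n) where

  private
    f′ : Perm n
    f′ = transposition ix iy ⊙ f

  Merged-step : ∀ {u} v → Merged f x y u v → Merged f x y u (f′ · v)
  Merged-step v m with swap x y (f · v) | swapView x y (f · v)
  Merged-step v (inj₁ p) | _ | other _ _ = inj₁ (next p)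
  Merged-step v (inj₂ (inj₁ (p , q))) | _ | other _ _ = inj₂ (inj₁ (p , next q))
  Merged-step v (inj₂ (inj₂ (p , q))) | _ | other _ _ = inj₂ (inj₂ (p , next q))
  Merged-step v (inj₁ p) | _ | left e = inj₂ (inj₁ (~-trans p (edge e) , here))
  Merged-step v (inj₂ (inj₁ (p , q))) | _ | left e = inj₂ (inj₁ (p , here))
  Merged-step v (inj₂ (inj₂ (p , q))) | _ | left e = inj₁ p
  Merged-step v (inj₁ p) | _ | right e = inj₂ (inj₂ (~-trans p (edge e) , here))
  Merged-step v (inj₂ (inj₁ (p , q))) | _ | right e = inj₁ p
  Merged-step v (inj₂ (inj₂ (p , q))) | _ | right e = inj₂ (inj₂ (p , here))

  ~-merged : ∀ {u v} → f′ ⊢ u ~ v → Merged f x y u v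
  ~-merged p = ~-preserves (Merged f x y _) Merged-step p (inj₁ here)

  -- The cycle of `y` avoids `x`, so `(x y) f` follows `f` along it up to the predecessor of `y`,
  -- which is then sent to `x`.
  swap-joins : ¬ f ⊢ x ~ y → f′ ⊢ x ~ y
  swap-joins x≁y with follow (~-sym (edge (inv-right f y)))
    where
    follow : ∀ {v} → f ⊢ y ~ v → f′ ⊢ y ~ x ⊎ f′ ⊢ y ~ v
    follow here = inj₂ here
    follow (next {v} p) with follow p | next {f = f′} {y = v}
    ... | inj₁ q | _ = inj₁ q
    ... | inj₂ q | step with swap x y (f · v) | swapView x y (f · v)
    ...   | _ | other _ _ = inj₂ (step q)
    ...   | _ | left e = contradiction (~-sym (subst (f ⊢ y ~_) e (next p))) x≁y
    ...   | _ | right e = inj₁ (step q)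
  ... | inj₁ q = ~-sym q
  ... | inj₂ q = ~-sym (~-trans q (edge (trans (cong (swap x y) (inv-right f y)) (swap-right x y))))

  ~-swap : f′ ⊢ x ~ y → ∀ {u v} → f ⊢ u ~ v → f′ ⊢ u ~ v
  ~-swap x~y here = here
  ~-swap x~y (next {v} p) with next (~-swap x~y p)
  ... | q with swap x y (f · v) | swapView x y (f · v)
  ...   | _ | other _ _ = q
  ...   | _ | left e = subst (f′ ⊢ _ ~_) (sym e) (~-trans q (~-sym x~y))
  ...   | _ | right e = subst (f′ ⊢ _ ~_) (sym e) (~-trans q x~y)

  -- With d minimal such that fᵈ x = y, the set {x, f x, …, fᵈ⁻¹ x} is closed under (x y) f.
  swap-separates : x ≢ y → f ⊢ x ~ y → ¬ f′ ⊢ x ~ y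
  swap-separates x≢y x~y x~′y with ~-bounded x~y
  ... | k , _ , _ , e with first-hit k e
    where
    first-hit : ∀ k → iter (f ·_) k x ≡ y → ∃[ d ] iter (f ·_) d x ≡ y × (∀ j → j < d → iter (f ·_) j x ≢ y)
    first-hit = <-rec _ λ k rec e → case anyUpTo? (λ j → iter (f ·_) j x ≟ y) k of λ where
      (yes (j , lt , e′)) → rec lt e′
      (no none) → k , e , λ j lt e′ → none (j , lt , e′)
  ... | d , hit , before = let i , lt , e′ = ~-preserves Arc closed x~′y (0 , 0<d , refl) in before i lt e′
    where
    Arc : ℕ → Set
    Arc u = ∃[ i ] i < d × iter (f ·_) i x ≡ u
    0<d : 0 < d
    0<d = n≢0⇒n>0 λ e → x≢y (subst (λ m → iter (f ·_) m x ≡ y) e hit)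
    no-return : ∀ i → i < d → iter (f ·_) (suc i) x ≢ x
    no-return i lt e with m≤n⇒∃[o]m+o≡n lt
    ... | o , i+o≡d = before o (≤-trans (s≤s (m≤n+m o i)) (≤-reflexive i+o≡d))
      (trans (cong (iter (f ·_) o) (sym e)) (trans (sym (iter-+ {f = f} o (suc i) x))
        (trans (cong (λ m → iter (f ·_) m x) (trans (+-comm o (suc i)) i+o≡d)) hit)))
    closed : ∀ u → Arc u → Arc (f′ · u)
    closed _ (i , lt , refl) with swap x y (f · iter (f ·_) i x) | swapView x y (f · iter (f ·_) i x)
    ... | _ | left e = contradiction e (no-return i lt)
    ... | _ | right _ = 0 , 0<d , refl
    ... | _ | other _ ne with m≤n⇒m<n∨m≡n lt
    ...   | inj₁ lt′ = suc i , lt′ , refl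
    ...   | inj₂ e = contradiction (subst (λ m → iter (f ·_) m x ≡ y) (sym e) hit) ne

  cycles-join : ¬ f ⊢ x ~ y → cycles f ≡ suc (cycles f′)
  cycles-join x≁y = cycles-merge f f′ ix iy (~-swap x~′y) x~′y ~-merged x≁y
    where x~′y = swap-joins x≁y

-- This is `cycles-join` read backwards: in the product `x` and `y` are separated, and a second
-- factor `(x y)` restores `f`.
cycles-split : ∀ {x y} (ix : In n x) (iy : In n y) (f : Perm n) → x ≢ y → f ⊢ x ~ y →
  cycles (transposition ix iy ⊙ f) ≡ suc (cycles f)
cycles-split {x = x} {y} ix iy f x≢y x~y = trans
  (cycles-join ix iy (transposition ix iy ⊙ f) (swap-separates ix iy f x≢y x~y))
  (cong suc (cycles-cong (transposition ix iy ⊙ transposition ix iy ⊙ f) f λ u → swap-involutive x y (f · u)))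

cycles-id : (f : Perm n) → (∀ x → f · x ≡ x) → cycles f ≡ n
cycles-id {n} f e = trans (cycles≡count f)
  (count-true n λ u _ → Least⇒isLeast f λ p → ≤-reflexive (sym (~-fixed (e (suc u)) p)))

cycles-swap-≤ : ∀ {x y} (ix : In n x) (iy : In n y) (f : Perm n) →
  cycles f ≤ suc (cycles (transposition ix iy ⊙ f))
cycles-swap-≤ {x = x} {y} ix iy f with ~-dec {f = f} x y
... | no x≁y = ≤-reflexive (cycles-join ix iy f x≁y)
... | yes x~y with x ≟ y
...   | no x≢y = ≤-trans (m≤n+m _ 2) (≤-reflexive (cong suc (sym (cycles-split ix iy f x≢y x~y))))
...   | yes refl = m≤n⇒m≤1+n (≤-reflexive (cycles-cong f (transposition ix iy ⊙ f)
                     λ u → sym (swap-trivial (f · u))))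
  where
  swap-trivial : ∀ u → swap x x u ≡ u
  swap-trivial u with swap x x u | swapView x x u
  ... | _ | left e = sym e
  ... | _ | right e = sym e
  ... | _ | other _ _ = refl

-- Removing a point from its cycle, and nonnegativity of the genus

moved-In : (f : Perm n) → ∀ {x} → f · x ≢ x → In n x
moved-In f ne = ~-In-≢ (next {f = f} here) (ne ∘ sym)

-- The bypass of `x`: its predecessor is sent straight to `g · x`, and `x` becomes a fixed point.
remove : ∀ {x} → In n x → Perm n → Perm n
remove i g = transposition i (·-In g i) ⊙ g

remove-fixed : ∀ {x} (i : In n x) (g : Perm n) → remove i g · x ≡ x
remove-fixed {x = x} i g = swap-right x (g · x)

cycles-remove : ∀ {x} (i : In n x) (g : Perm n) → g · x ≢ x → cycles (remove i g) ≡ suc (cycles g)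
cycles-remove i g ne = cycles-split i (·-In g i) g (ne ∘ sym) (edge refl)

~-remove : ∀ {x} (i : In n x) (g : Perm n) → ∀ {u v} → remove i g ⊢ u ~ v → g ⊢ u ~ v
~-remove i g p with ~-merged i (·-In g i) g p
... | inj₁ q = q
... | inj₂ (inj₁ (q , r)) = ~-trans q (~-trans (edge refl) r)
... | inj₂ (inj₂ (q , r)) = ~-trans q (~-trans (~-sym (edge refl)) r)

moved? : (f : Perm n) → (∃[ x ] f · x ≢ x) ⊎ (∀ x → f · x ≡ x)
moved? {n} f with anyUpTo? (λ x → ¬? (f · x ≟ x)) (suc n)
... | yes (x , _ , ne) = inj₁ (x , ne)
... | no none = inj₂ fixed
  where
  fixed : ∀ x → f · x ≡ x
  fixed x with f · x ≟ x
  ... | yes e = e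
  ... | no ne = contradiction (x , s≤s (In.upper (moved-In f ne)) , ne) none

-- When `f ⊙ g` is an n-cycle, this says that the genus is nonnegative. Removing a moved point
-- raises `cycles g` by exactly one, so it suffices to control the change in the product.
genus-≥0 : (f g : Perm n) → cycles f + cycles g ≤ n + cycles (f ⊙ g)
genus-≥0 {n} f g = go n g (m≤n+m n (cycles g))
  where
  -- `m` bounds the deficiency n - z(g), which every removal lowers by one; at 0 a further removal
  -- would yield more than n cycles.
  go : ∀ m (g : Perm n) → n ≤ cycles g + m → cycles f + cycles g ≤ n + cycles (f ⊙ g)
  go m g b with moved? g
  ... | inj₂ e = ≤-reflexive (trans (+-comm (cycles f) (cycles g)) (cong₂ _+_ (cycles-id g e)
                   (cycles-cong f (f ⊙ g) λ x → cong (f ·_) (sym (e x)))))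
  go zero g b | inj₁ (x , ne) = contradiction
    (≤-trans (≤-reflexive (sym (cycles-remove i g ne))) (cycles-≤ (remove i g)))
    (<⇒≱ (s≤s (≤-trans b (≤-reflexive (+-identityʳ _)))))
    where i = moved-In g ne
  go (suc m) g b | inj₁ (x , ne) = ≤-pred (begin
    suc (cycles f + cycles g)       ≡⟨ +-suc (cycles f) (cycles g) ⟨
    cycles f + suc (cycles g)       ≡⟨ cong (cycles f +_) (cycles-remove i g ne) ⟨
    cycles f + cycles g′            ≤⟨ go m g′ b′ ⟩
    -- The products with `g′` and with `g` differ by the one transposition (f x, f (g x)), which
    -- lowers the count by at most one.
    n + cycles (f ⊙ g′)             ≤⟨ +-monoʳ-≤ n (cycles-swap-≤ fi (·-In f (·-In g i)) (f ⊙ g′)) ⟩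
    n + suc (cycles (transposition fi (·-In f (·-In g i)) ⊙ f ⊙ g′))
      ≡⟨ cong (λ c → n + suc c) (cycles-cong (transposition fi (·-In f (·-In g i)) ⊙ f ⊙ g′) (f ⊙ g) λ u →
           trans (sym (swap-equivariant f x (g · x) (g′ · u))) (cong (f ·_) (swap-involutive x (g · x) (g · u)))) ⟩
    n + suc (cycles (f ⊙ g))        ≡⟨ +-suc n _ ⟩
    suc (n + cycles (f ⊙ g))        ∎)
    where
    open ≤-Reasoning
    i = moved-In g ne
    fi = ·-In f i
    g′ = remove i g
    b′ : n ≤ cycles g′ + m
    b′ = ≤-trans b (≤-reflexive (trans (+-suc _ m) (cong (_+ m) (sym (cycles-remove i g ne)))))

-- The rotation

-- `ζ n` sends every label off the range to 1 and so is no bijection of ℕ; here those labels are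
-- fixed.
rotation : 1 ≤ n → Perm n
rotation {n} 1≤n = record
  { _·_ = to ; inv = from ; inv-left = from-to ; inv-right = to-from ; fix = fixed }
  where
  to from : ℕ → ℕ
  to zero = zero
  to (suc x) with <-cmp (suc x) n
  ... | tri< _ _ _ = suc (suc x)
  ... | tri≈ _ _ _ = 1
  ... | tri> _ _ _ = suc x
  from zero = zero
  from (suc zero) = n
  from (suc (suc x)) with suc (suc x) ≤? n
  ... | yes _ = suc x
  ... | no _ = suc (suc x)
  from-to : ∀ x → from (to x) ≡ x
  from-to zero = refl
  from-to (suc x) with <-cmp (suc x) n
  ... | tri≈ _ e _ = sym e
  from-to (suc x) | tri< lt _ _ with suc (suc x) ≤? n
  ... | yes _ = refl
  ... | no nle = contradiction lt nle
  from-to (suc zero) | tri> _ _ gt = contradiction 1≤n (<⇒≱ gt)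
  from-to (suc (suc x)) | tri> nlt _ gt with suc (suc x) ≤? n
  ... | yes le = contradiction le (<⇒≱ gt)
  ... | no _ = refl
  to-last : ∀ {x} → 1 ≤ x → x ≡ n → to x ≡ 1
  to-last {suc x} _ e with <-cmp (suc x) n
  ... | tri< _ ne _ = contradiction e ne
  ... | tri≈ _ _ _ = refl
  ... | tri> _ ne _ = contradiction e ne
  to-from : ∀ x → to (from x) ≡ x
  to-from zero = refl
  to-from (suc zero) = to-last 1≤n refl
  to-from (suc (suc x)) with suc (suc x) ≤? n
  to-from (suc (suc x)) | yes le with <-cmp (suc x) n
  ... | tri< _ _ _ = refl
  ... | tri≈ nlt _ _ = contradiction le nlt
  ... | tri> nlt _ _ = contradiction le nlt
  to-from (suc (suc x)) | no nle with <-cmp (suc (suc x)) n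
  ... | tri< lt _ _ = contradiction (<⇒≤ lt) nle
  ... | tri≈ _ e _ = contradiction (≤-reflexive e) nle
  ... | tri> _ _ _ = refl
  fixed : ∀ x → ¬ In n x → to x ≡ x
  fixed zero _ = refl
  fixed (suc x) ¬i with <-cmp (suc x) n
  ... | tri< lt _ _ = contradiction (s≤s z≤n , <⇒≤ lt) ¬i
  ... | tri≈ _ e _ = contradiction (s≤s z≤n , ≤-reflexive e) ¬i
  ... | tri> _ _ _ = refl

module _ (1≤n : 1 ≤ n) where

  rotation-suc : ∀ {x} → 1 ≤ x → x < n → rotation 1≤n · x ≡ suc x
  rotation-suc {suc x} _ lt with <-cmp (suc x) n
  ... | tri< _ _ _ = refl
  ... | tri≈ nlt _ _ = contradiction lt nlt
  ... | tri> nlt _ _ = contradiction lt nlt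

  rotation-last : ∀ {x} → 1 ≤ x → x ≡ n → rotation 1≤n · x ≡ 1
  rotation-last {suc x} _ e with <-cmp (suc x) n
  ... | tri< _ ne _ = contradiction e ne
  ... | tri≈ _ _ _ = refl
  ... | tri> _ ne _ = contradiction e ne

  rotation-from-1 : ∀ u → suc u ≤ n → rotation 1≤n ⊢ 1 ~ suc u
  rotation-from-1 zero _ = here
  rotation-from-1 (suc u) lt = subst (rotation 1≤n ⊢ 1 ~_) (rotation-suc (s≤s z≤n) lt)
    (next (rotation-from-1 u (<⇒≤ lt)))

  cycles-rotation : cycles (rotation 1≤n) ≡ 1
  cycles-rotation = trans (cycles≡count (rotation 1≤n)) (trans
    (count-remove n 1≤n (Least⇒isLeast (rotation 1≤n) λ p → In.lower (~-In (≤-refl , 1≤n) p)) refl others)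
    (cong suc (count-false n)))
    where
    others : ∀ u → u < n → u ≢ 0 → isLeast (rotation 1≤n) (suc u) ≡ _
    others u lt ne = ≢true λ e → ne (n≤0⇒n≡0 (≤-pred
      (isLeast⇒Least (rotation 1≤n) (suc-In lt) e (~-sym (rotation-from-1 u lt)))))

-- Crossings

record Cuts (n : ℕ) : Set where
  field
    {a b c d} : ℕ
    1≤a : 1 ≤ a
    a<b : a < b
    b≤c : b ≤ c
    c<d : c < d
    d≤n : d ≤ n

  a<c : a < c
  a<c = <-≤-trans a<b b≤c
  b<d : b < d
  b<d = ≤-<-trans b≤c c<d
  inA : In n a
  inA = 1≤a , ≤-trans (<⇒≤ (<-trans a<b b<d)) d≤n
  inB : In n b
  inB = ≤-trans 1≤a (<⇒≤ a<b) , ≤-trans (<⇒≤ b<d) d≤n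
  inC : In n c
  inC = ≤-trans 1≤a (<⇒≤ a<c) , ≤-trans (<⇒≤ c<d) d≤n
  inD : In n d
  inD = ≤-trans 1≤a (<⇒≤ (<-trans a<b b<d)) , d≤n

  swapAC swapBD : Perm n
  swapAC = transposition inA inC
  swapBD = transposition inB inD

-- Multiplying f by (a c)(b d) splits cycles twice; if b = c this is a 3-cycle,
-- and f visits a, b, d in the order opposite to the cyclic order of the labels.
record Crossing {n} (f : Perm n) : Set where
  field
    cuts : Cuts n
  open Cuts cuts public
  field
    b~d : f ⊢ b ~ d
    a~c : swapBD ⊙ f ⊢ a ~ c

cycles-crossing : {f : Perm n} (X : Crossing f) (let open Crossing X) →
  cycles (swapAC ⊙ swapBD ⊙ f) ≡ 2 + cycles f
cycles-crossing {f = f} X = trans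
  (cycles-split inA inC (swapBD ⊙ f) (<⇒≢ a<c) a~c)
  (cong suc (cycles-split inB inD f (<⇒≢ b<d) b~d))
  where open Crossing X

~-swap-away : ∀ {x y} (ix : In n x) (iy : In n y) (f : Perm n) → ∀ {u v} →
  ¬ f ⊢ u ~ x → ¬ f ⊢ u ~ y → f ⊢ u ~ v → transposition ix iy ⊙ f ⊢ u ~ v
~-swap-away ix iy f u≁x u≁y here = here
~-swap-away {x = x} {y} ix iy f u≁x u≁y (next {v} p) with next (~-swap-away ix iy f u≁x u≁y p)
... | q with swap x y (f · v) | swapView x y (f · v)
...   | _ | other _ _ = q
...   | _ | left e = contradiction (subst (f ⊢ _ ~_) e (next p)) u≁x
...   | _ | right e = contradiction (subst (f ⊢ _ ~_) e (next p)) u≁y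

module _ (f : Perm n) where

  -- The factor `(b d)` splits the cycle of `b` and leaves the cycle through `a` and `c` intact.
  crossing-disjoint : ∀ {a b c d} → 1 ≤ a → a < b → b < c → c < d → d ≤ n →
    f ⊢ a ~ c → f ⊢ b ~ d → ¬ f ⊢ a ~ b → Crossing f
  crossing-disjoint 1≤a a<b b<c c<d d≤n a~c b~d a≁b = record
    { cuts = q
    ; b~d = b~d
    ; a~c = ~-swap-away (Cuts.inB q) (Cuts.inD q) f a≁b (λ p → a≁b (~-trans p (~-sym b~d))) a~c }
    where q = record { 1≤a = 1≤a ; a<b = a<b ; b≤c = <⇒≤ b<c ; c<d = c<d ; d≤n = d≤n }

  -- The cuts are x < u = u < f x; after `(b d)` the label `x` is sent directly to `u`.
  crossing-jump : ∀ {x u} → x < u → u < f · x → f ⊢ x ~ u → Crossing f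
  crossing-jump {x} {u} x<u u<fx x~u = record
    { cuts = record { 1≤a = In.lower i ; a<b = x<u ; b≤c = ≤-refl ; c<d = u<fx ; d≤n = In.upper (·-In f i) }
    ; b~d = ~-trans (~-sym x~u) (edge refl)
    ; a~c = edge (swap-right u (f · x)) }
    where i = moved-In f (λ e → <⇒≢ (<-trans x<u u<fx) (sym e))

  -- The cuts are f x < x = x < y; `(b d) = (x y)` does not touch `f · x`, so the edge from `x` to
  -- `f · x` survives.
  crossing-descent-below : ∀ {x y} → f · x < x → x < y → f ⊢ x ~ y → Crossing f
  crossing-descent-below {x} {y} fx<x x<y x~y = record
    { cuts = record { 1≤a = In.lower (·-In f i) ; a<b = fx<x ; b≤c = ≤-refl ; c<d = x<y ; d≤n = In.upper (~-In i x~y) }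
    ; b~d = x~y
    ; a~c = ~-sym (edge (swap-other (<⇒≢ fx<x) (<⇒≢ (<-trans fx<x x<y)))) }
    where i = moved-In f (<⇒≢ fx<x)

  -- The cuts are m < f x = f x < x. The factor `(b d)` turns `x` into a fixed point, so a path from
  -- `m` can only arrive at `f · x` without meeting `x`.
  crossing-descent-above : ∀ {m x} → m < f · x → f · x < x → f ⊢ m ~ x → Crossing f
  crossing-descent-above {m} {x} m<fx fx<x m~x = record
    { cuts = record { 1≤a = In.lower (~-In i (~-sym m~x)) ; a<b = m<fx ; b≤c = ≤-refl ; c<d = fx<x ; d≤n = In.upper i }
    ; b~d = ~-sym (edge refl)
    ; a~c = case ~-merged fi i f′ (~-cong (λ u → sym (swap-involutive (f · x) x (f · u))) (next m~x)) of λ where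
        (inj₁ p) → p
        (inj₂ (inj₁ (p , _))) → p
        (inj₂ (inj₂ (p , _))) → contradiction
          (sym (~-fixed (swap-left (f · x) x) (~-sym p))) (<⇒≢ (<-trans m<fx fx<x) ∘ sym) }
    where
    i = moved-In f (<⇒≢ fx<x)
    fi = ·-In f i
    f′ = transposition fi i ⊙ f

-- Orbits only grow when `x` is put back. For the second condition the removal is interchanged with
-- `(b d)`: being fixed by `remove i g`, the label `x` is neither `b` nor `d`.
crossing-remove : ∀ {x} (i : In n x) (g : Perm n) → Crossing (remove i g) → Crossing g
crossing-remove {x = x} i g X = record
  { cuts = cuts
  ; b~d = ~-remove i g b~d
  ; a~c = ~-remove i (swapBD ⊙ g) (~-cong commute a~c) }
  where
  open Crossing X
  g′ = remove i g
  x≢b : x ≢ b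
  x≢b refl = <⇒≢ b<d (sym (~-fixed (remove-fixed i g) b~d))
  x≢d : x ≢ d
  x≢d refl = <⇒≢ b<d (~-fixed (remove-fixed i g) (~-sym b~d))
  commute : ∀ u → (swapBD ⊙ g′) · u ≡ remove i (swapBD ⊙ g) · u
  commute u = trans (swap-equivariant swapBD x (g · x) (g · u))
    (cong (λ v → swap v (swap b d (g · x)) (swap b d (g · u))) (swap-other x≢b x≢d))

-- Genus zero and absence of crossings

excedance? : (f : Perm n) → (∃[ x ] x < f · x) ⊎ (∀ x → f · x ≡ x)
excedance? {n} f with anyUpTo? (λ x → x <? f · x) (suc n)
... | yes (x , _ , lt) = inj₁ (x , lt)
... | no none = inj₂ (<-rec _ fixed)
  where
  fixed : ∀ x → (∀ {y} → y < x → f · y ≡ y) → f · x ≡ x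
  fixed x rec with <-cmp (f · x) x
  -- The smaller label `f · x` is already known to be fixed, and injectivity then makes it equal to
  -- `x`.
  ... | tri< lt ne _ = injective f (rec lt)
  ... | tri≈ _ e _ = e
  ... | tri> _ ne gt = contradiction (x , s≤s (In.upper (moved-In f ne)) , gt) none

module _ (1≤n : 1 ≤ n) where

  private ζ̂ = rotation 1≤n

  -- If gx = y > x lies in the f-cycle of x, then the interval (x, y] cannot be f-closed,
  -- which produces an edge v → u of g leaving (x, y).
  crossing-excedance : (f g : Perm n) → (∀ u → f · g · u ≡ ζ̂ · u) →
    ∀ {x} → x < g · x → f ⊢ x ~ g · x → Crossing g
  crossing-excedance f g fg {x} x<y x~y with anyUpTo? (λ u → x <? u ×-dec ¬? (x <? inv g u ×-dec inv g u <? g · x)) (g · x)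
  ... | no none = contradiction (proj₁ (~-preserves Inside closed (~-sym x~y) (x<y , ≤-refl))) (<-irrefl refl)
    where
    y = g · x
    i : In n x
    i = moved-In g (<⇒≢ x<y ∘ sym)
    y≤n : y ≤ n
    y≤n = In.upper (·-In g i)
    Inside : ℕ → Set
    Inside u = x < u × u ≤ y
    fζ : ∀ {u v} → g · v ≡ u → 1 ≤ v → v < n → f · u ≡ suc v
    fζ {v = v} refl 1≤v v<n = trans (fg v) (rotation-suc 1≤n 1≤v v<n)
    closed : ∀ u → Inside u → Inside (f · u)
    closed u (x<u , u≤y) with m≤n⇒m<n∨m≡n u≤y
    ... | inj₂ refl = subst Inside (sym (fζ refl (In.lower i) (<-≤-trans x<y y≤n))) (≤-refl , x<y)
    ... | inj₁ u<y with x <? inv g u ×-dec inv g u <? y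
    ...   | yes (x<v , v<y) = subst Inside
              (sym (fζ (inv-right g u) (≤-trans (In.lower i) (<⇒≤ x<v)) (<-≤-trans v<y y≤n)))
              (m<n⇒m<1+n x<v , v<y)
    ...   | no out = contradiction (u , u<y , x<u , out) none
  -- Write v for `inv g u`. If `u` is on the `g`-cycle of `x`, the edge from `x` to `g · x` jumps
  -- over it. Otherwise v is neither `x` nor `g · x`, and the edge from v to `u` interleaves with it
  -- from the left or from the right.
  ... | yes (u , u<y , x<u , out) with ~-dec {f = g} x u
  ...   | yes x~u = crossing-jump g x<u u<y x~u
  ...   | no x≁u with <-cmp (inv g u) x
  ...     | tri< v<x _ _ = crossing-disjoint g (In.lower (~-In iu (~-sym v~u))) v<x x<u u<y (In.upper (·-In g ix)) v~u (edge refl)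
              (λ v~x → x≁u (~-trans (~-sym v~x) v~u))
    where
    ix : In n x
    ix = moved-In g (<⇒≢ x<y ∘ sym)
    iu : In n u
    iu = ≤-trans (In.lower ix) (<⇒≤ x<u) , ≤-trans (<⇒≤ u<y) (In.upper (·-In g ix))
    v~u : g ⊢ inv g u ~ u
    v~u = edge (inv-right g u)
  ...     | tri≈ _ e _ = contradiction (edge (trans (cong (g ·_) (sym e)) (inv-right g u))) x≁u
  ...     | tri> _ _ x<v = crossing-disjoint g (In.lower ix) x<u u<y y<v (In.upper (~-In iu (~-sym v~u))) (edge refl) (~-sym v~u) x≁u
    where
    ix : In n x
    ix = moved-In g (<⇒≢ x<y ∘ sym)
    iu : In n u
    iu = ≤-trans (In.lower ix) (<⇒≤ x<u) , ≤-trans (<⇒≤ u<y) (In.upper (·-In g ix))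
    v~u : g ⊢ inv g u ~ u
    v~u = edge (inv-right g u)
    y<v : g · x < inv g u
    y<v = ≤∧≢⇒< (≮⇒≥ (λ v<y → out (x<v , v<y)))
      (λ e → x≁u (~-trans (edge refl) (subst (g ⊢ _ ~_) (inv-right g u) (edge (cong (g ·_) e)))))

  genus-0-or-crossing : (f g : Perm n) → (∀ u → f · g · u ≡ ζ̂ · u) →
    cycles f + cycles g ≡ n + 1 ⊎ Crossing g
  genus-0-or-crossing f g = go n f g (m≤n+m n (cycles g))
    where
    go : ∀ m (f g : Perm n) → n ≤ cycles g + m → (∀ u → f · g · u ≡ ζ̂ · u) →
      cycles f + cycles g ≡ n + 1 ⊎ Crossing g
    go m f g b fg with excedance? g
    ... | inj₂ e = inj₁ (trans (+-comm (cycles f) (cycles g)) (cong₂ _+_ (cycles-id g e)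
          (trans (cycles-cong f ζ̂ λ u → trans (cong (f ·_) (sym (e u))) (fg u)) (cycles-rotation 1≤n))))
    ... | inj₁ (x , lt) with ~-dec {f = f} x (g · x)
    ...   | yes p = inj₂ (crossing-excedance f g fg lt p)
    go zero f g b fg | inj₁ (x , lt) | no _ = contradiction
      (≤-trans (≤-reflexive (sym (cycles-remove i g ne))) (cycles-≤ (remove i g)))
      (<⇒≱ (s≤s (≤-trans b (≤-reflexive (+-identityʳ _)))))
      where
      ne = <⇒≢ lt ∘ sym
      i = moved-In g ne
    go (suc m) f g b fg | inj₁ (x , lt) | no x≁y = case go m f′ g′ b′ fg′ of λ where
        (inj₁ e) → inj₁ (trans total e)
        (inj₂ X) → inj₂ (crossing-remove i g X)
      where
      y = g · x
      ne = <⇒≢ lt ∘ sym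
      i = moved-In g ne
      j = ·-In g i
      g′ = remove i g
      -- By `swap-equivariant` this factor cancels the `(x y)` that the removal puts into `g`, so
      -- the product is still the rotation.
      f′ = transposition (·-In f i) (·-In f j) ⊙ f
      b′ : n ≤ cycles g′ + m
      b′ = ≤-trans b (≤-reflexive (trans (+-suc _ m) (cong (_+ m) (sym (cycles-remove i g ne)))))
      fg′ : ∀ u → f′ · g′ · u ≡ ζ̂ · u
      fg′ u = trans (sym (swap-equivariant f x y (g′ · u))) (trans (cong (f ·_) (swap-involutive x y (g · u))) (fg u))
      fx≁fy : ¬ f ⊢ f · x ~ f · y
      fx≁fy p = x≁y (~-trans (edge refl) (~-trans p (~-sym (edge refl))))
      total : cycles f + cycles g ≡ cycles f′ + cycles g′
      total = trans (cong (_+ cycles g) (cycles-join (·-In f i) (·-In f j) f fx≁fy))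
        (trans (sym (+-suc (cycles f′) (cycles g))) (cong (cycles f′ +_) (sym (cycles-remove i g ne))))

  -- The product (a c)(b d) ζ is still one cycle: `(b d)` cuts off the labels in [b, d), and `(a c)`
  -- reconnects the two parts, because `c` lies in that interval and `a` does not. Since the cycle
  -- count of `f` goes up by two, `genus-≥0` would give n + 3 ≤ n + 1.
  genus-0-uncrossed : (f g : Perm n) → (∀ u → f · g · u ≡ ζ̂ · u) →
    cycles f + cycles g ≡ n + 1 → ¬ Crossing f
  genus-0-uncrossed f g fg e X = <-irrefl refl (begin-strict
    n + 1                                ≡⟨ e ⟨
    cycles f + cycles g                  <⟨ s≤s (n≤1+n _) ⟩
    2 + cycles f + cycles g              ≡⟨ cong (_+ cycles g) (cycles-crossing X) ⟨
    cycles f″ + cycles g                 ≤⟨ genus-≥0 f″ g ⟩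
    n + cycles (f″ ⊙ g)                  ≡⟨ cong (n +_) (cycles-cong (f″ ⊙ g) ζ″ λ u → cong (λ v → swapAC · swapBD · v) (fg u)) ⟩
    n + cycles ζ″                        ≤⟨ +-monoʳ-≤ n single ⟩
    n + 1                                ∎)
    where
    open ≤-Reasoning
    open Crossing X
    f″ = swapAC ⊙ swapBD ⊙ f
    ζ′ = swapBD ⊙ ζ̂
    ζ″ = swapAC ⊙ ζ′
    Inside : ℕ → Set
    Inside u = b ≤ u × u < d
    closed : ∀ u → Inside u → Inside (ζ′ · u)
    closed u (b≤u , u<d) rewrite rotation-suc 1≤n (≤-trans (In.lower inB) b≤u) (<-≤-trans u<d d≤n)
      with swap b d (suc u) | swapView b d (suc u)
    ... | _ | left e = contradiction b≤u (<⇒≱ (≤-reflexive e))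
    ... | _ | right e = ≤-refl , b<d
    ... | _ | other _ ne = m≤n⇒m≤1+n b≤u , ≤∧≢⇒< u<d ne
    a≁c : ¬ ζ′ ⊢ a ~ c
    a≁c p = <⇒≱ a<b (proj₁ (~-preserves Inside closed (~-sym p) (b≤c , c<d)))
    1~ : ∀ {x} → In n x → ζ̂ ⊢ 1 ~ x
    1~ {suc x} (_ , le) = rotation-from-1 1≤n x le
    single : cycles ζ″ ≤ 1
    single = ≤-pred (begin
      suc (cycles ζ″)  ≡⟨ cycles-join inA inC ζ′ a≁c ⟨
      cycles ζ′        ≡⟨ cycles-split inB inD ζ̂ (<⇒≢ b<d) (~-trans (~-sym (1~ inB)) (1~ inD)) ⟩
      suc (cycles ζ̂)   ≡⟨ cong suc (cycles-rotation 1≤n) ⟩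
      2                ∎)

-- Noncrossing partitions

firstFrom-just : ∀ (p : ℕ → Bool) a len {y} → a ≤ y → y < a + len → p y ≡ true →
  (∀ w → a ≤ w → w < y → p w ≡ false) → firstFrom p a len ≡ just y
firstFrom-just p a zero a≤y y<a _ _ = contradiction a≤y (<⇒≱ (<-≤-trans y<a (≤-reflexive (+-identityʳ a))))
firstFrom-just p a (suc len) a≤y y<end py before with m≤n⇒m<n∨m≡n a≤y
... | inj₂ refl rewrite py = refl
... | inj₁ a<y rewrite before a ≤-refl a<y =
  firstFrom-just p (suc a) len a<y (<-≤-trans y<end (≤-reflexive (+-suc a len))) py
    (λ w a<w w<y → before w (<⇒≤ a<w) w<y)

firstFrom-nothing : ∀ (p : ℕ → Bool) a len → (∀ w → a ≤ w → w < a + len → p w ≡ false) →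
  firstFrom p a len ≡ nothing
firstFrom-nothing p a zero _ = refl
firstFrom-nothing p a (suc len) none
  rewrite none a ≤-refl (≤-trans (s≤s (m≤m+n a len)) (≤-reflexive (sym (+-suc a len)))) =
  firstFrom-nothing p (suc a) len
    (λ w a<w w<end → none w (<⇒≤ a<w) (<-≤-trans w<end (≤-reflexive (sym (+-suc a len)))))

module _ (f : Perm n) where

  block : ℕ → ℕ
  block x = proj₁ (least {f = f} x)

  block⇒~ : ∀ {x y} → block x ≡ block y → f ⊢ x ~ y
  block⇒~ {x} {y} e = ~-trans (proj₁ (proj₂ (least x)))
    (subst (λ m → f ⊢ m ~ y) (sym e) (~-sym (proj₁ (proj₂ (least y)))))

  ~⇒block : ∀ {x y} → f ⊢ x ~ y → block x ≡ block y
  ~⇒block {x} {y} p = least-unique (proj₂ (proj₂ (least x))) (proj₂ (proj₂ (least y)))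
    (~-trans (~-sym (proj₁ (proj₂ (least x)))) (~-trans p (proj₁ (proj₂ (least y)))))

  ~⇒same : ∀ {x y} → f ⊢ y ~ x → (block y ≡ᵇ block x) ≡ true
  ~⇒same p = T⇒true (≡⇒≡ᵇ _ _ (~⇒block p))

  ≁⇒different : ∀ {x y} → ¬ f ⊢ y ~ x → (block y ≡ᵇ block x) ≡ false
  ≁⇒different ne = ≢true λ e → ne (block⇒~ (≡ᵇ⇒≡ _ _ (true⇒T e)))

  uncrossed⇒noncrossing : ¬ Crossing f → NonCrossing n block
  uncrossed⇒noncrossing un a c a′ c′ 1≤a a<c c<a′ a′<c′ c′≤n aa cc = ~⇒block
    (decidable-stable (~-dec a c) λ a≁c →
      un (crossing-disjoint f 1≤a a<c c<a′ a′<c′ c′≤n (block⇒~ aa) (block⇒~ cc) a≁c))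

  -- On an ascent, a block member between `x` and `f · x` would be a jump. On a descent, a member
  -- above `x` or below `f · x` would give a crossing, so `x` is the block maximum and `f · x` the
  -- minimum, the fallback value of `β`.
  uncrossed⇒β : ¬ Crossing f → ∀ {x} → In n x → β n block x ≡ f · x
  uncrossed⇒β un {x} i with <-cmp x (f · x)
  ... | tri< x<fx _ _ = cong (fromMaybe (fromMaybe x (firstFrom _ 1 n)))
    (firstFrom-just (λ y → block y ≡ᵇ block x) (suc x) (n ∸ x) x<fx
      (s≤s (≤-trans (In.upper (·-In f i)) (≤-reflexive (sym (m+[n∸m]≡n (In.upper i))))))
      (~⇒same (~-sym (edge refl)))
      (λ w x<w w<fx → ≁⇒different λ p → un (crossing-jump f x<w w<fx (~-sym p))))
  -- A singleton block: the upward search fails, and the search from 1 finds `x` itself.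
  ... | tri≈ _ x≡fx _ = trans
    (cong₂ (λ s t → fromMaybe (fromMaybe x s) t)
      (firstFrom-just (λ y → block y ≡ᵇ block x) 1 n (In.lower i) (s≤s (In.upper i)) (~⇒same {x} here)
        (λ w _ w<x → ≁⇒different λ p → <⇒≢ w<x (~-fixed (sym x≡fx) (~-sym p))))
      (firstFrom-nothing (λ y → block y ≡ᵇ block x) (suc x) (n ∸ x)
        (λ w x<w _ → ≁⇒different λ p → <⇒≢ x<w (sym (~-fixed (sym x≡fx) (~-sym p))))))
    x≡fx
  ... | tri> _ _ fx<x =
    cong₂ (λ s t → fromMaybe (fromMaybe x s) t)
      (firstFrom-just (λ y → block y ≡ᵇ block x) 1 n (In.lower (·-In f i)) (s≤s (In.upper (·-In f i)))
        (~⇒same (~-sym (edge refl)))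
        (λ w _ w<fx → ≁⇒different λ p → un (crossing-descent-above f w<fx fx<x p)))
      (firstFrom-nothing (λ y → block y ≡ᵇ block x) (suc x) (n ∸ x)
        (λ w x<w _ → ≁⇒different λ p → un (crossing-descent-below f fx<x x<w (~-sym p))))

-- The four-coloring of a crossing

≤ᵇ-true : ∀ {m n} → m ≤ n → (m ≤ᵇ n) ≡ true
≤ᵇ-true le = T⇒true (≤⇒≤ᵇ le)

≤ᵇ-false : ∀ {m n} → n < m → (m ≤ᵇ n) ≡ false
≤ᵇ-false lt = ≢true λ e → <⇒≱ lt (≤ᵇ⇒≤ _ _ (true⇒T e))

<ᵇ-true : ∀ {m n} → m < n → (m <ᵇ n) ≡ true
<ᵇ-true = ≤ᵇ-true

<ᵇ-false : ∀ {m n} → n ≤ m → (m <ᵇ n) ≡ false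
<ᵇ-false le = ≤ᵇ-false (s≤s le)

-- Reduces each truncated subtraction in `φ` and `φ⁻¹` to an equation between sums.
∸-from-+ : ∀ n {m o} → m ≡ n + o → m ∸ n ≡ o
∸-from-+ n {o = o} refl = m+n∸m≡n n o

-- A label is a left end plus a positive offset, so that `φ` exchanges one left end for another;
-- `low` and `high` together make up the class A.
data Region (p q r s : ℕ) : ℕ → Set where
  low    : ∀ {x} → x ≤ p → Region p q r s x
  first  : ∀ {u} → p + suc u ≤ q → Region p q r s (p + suc u)
  second : ∀ {u} → q + suc u ≤ r → Region p q r s (q + suc u)
  third  : ∀ {u} → r + suc u ≤ s → Region p q r s (r + suc u)
  high   : ∀ {x} → s < x → Region p q r s x

offset : ∀ {p x} → p < x → ∃[ u ] p + suc u ≡ x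
offset {p} lt with m≤n⇒∃[o]m+o≡n lt
... | u , e = u , trans (+-suc p u) e

region : ∀ p q r s x → Region p q r s x
region p q r s x with x ≤? p
... | yes x≤p = low x≤p
... | no x≰p with offset (≰⇒> x≰p) | x ≤? q
...   | _ , refl | yes x≤q = first x≤q
...   | _ | no x≰q with offset (≰⇒> x≰q) | x ≤? r
...     | _ , refl | yes x≤r = second x≤r
...     | _ | no x≰r with offset (≰⇒> x≰r) | x ≤? s
...       | _ , refl | yes x≤s = third x≤s
...       | _ | no x≰s = high (≰⇒> x≰s)

shift : ∀ {p q p′ q′ u} L → p + L ≡ q → p′ + L ≡ q′ → p + suc u ≤ q → p′ + suc u ≤ q′
shift {p} {p′ = p′} L refl refl le = +-monoʳ-≤ p′ (+-cancelˡ-≤ p _ _ le)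

-- φ translates the color classes (a, j], (j, k], (k, d], of sizes B, C, D, onto (c, d], (b, c], (a, b].
module Recoloring {n} (q : Cuts n) where
  open Cuts q

  B C D j k : ℕ
  B = d ∸ c
  C = c ∸ b
  D = b ∸ a
  j = a + B
  k = j + C

  a+D : a + D ≡ b
  a+D = m+[n∸m]≡n (<⇒≤ a<b)
  b+C : b + C ≡ c
  b+C = m+[n∸m]≡n b≤c
  c+B : c + B ≡ d
  c+B = m+[n∸m]≡n (<⇒≤ c<d)
  a+d≡k+b : a + d ≡ k + b
  a+d≡k+b = begin
    a + d                ≡⟨ cong (a +_) (sym c+B) ⟩
    a + (c + B)          ≡⟨ cong (λ v → a + (v + B)) (sym b+C) ⟩
    a + (b + C + B)      ≡⟨ rearrange a b C B ⟩
    a + B + C + b        ∎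
    where
    open ≡-Reasoning
    rearrange : ∀ a b C B → a + (b + C + B) ≡ a + B + C + b
    rearrange = solve-∀
  a+d≡j+c : a + d ≡ j + c
  a+d≡j+c = trans (cong (a +_) (trans (sym c+B) (+-comm c B))) (sym (+-assoc a B c))
  k+D : k + D ≡ d
  k+D = +-cancelˡ-≡ a _ _ (begin
    a + (k + D)  ≡⟨ rearrange a k D ⟩
    k + (a + D)  ≡⟨ cong (k +_) a+D ⟩
    k + b        ≡⟨ a+d≡k+b ⟨
    a + d        ∎)
    where
    open ≡-Reasoning
    rearrange : ∀ a k D → a + (k + D) ≡ k + (a + D)
    rearrange = solve-∀

  -- The thresholds at which `φ⁻¹` changes its formula are the cuts `b` and `c`.
  a+d∸k≡b : a + d ∸ k ≡ b
  a+d∸k≡b = ∸-from-+ k a+d≡k+b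
  a+d∸j≡c : a + d ∸ j ≡ c
  a+d∸j≡c = ∸-from-+ j a+d≡j+c

  a<j : a < j
  a<j = m<m+n a (m<n⇒0<n∸m c<d)
  j≤k : j ≤ k
  j≤k = m≤m+n j C
  k<d : k < d
  k<d = <-≤-trans (m<m+n k (m<n⇒0<n∸m a<b)) (≤-reflexive k+D)

  γ : FourColoring n
  γ = fc a j k d 1≤a a<j j≤k k<d d≤n

  φ-low : ∀ {x} → x ≤ a → φ γ x ≡ x
  φ-low le rewrite ≤ᵇ-true le = refl

  a<-high : ∀ {x} → d < x → a < x
  a<-high = <-trans (<-trans a<b b<d)

  φ-high : ∀ {x} → d < x → φ γ x ≡ x
  φ-high lt rewrite ≤ᵇ-false (a<-high lt) | <ᵇ-true lt = refl

  p<p+suc : ∀ p {u} → p < p + suc u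
  p<p+suc p {u} = m<m+n p z<s

  φ-first : ∀ {u} → a + suc u ≤ j → φ γ (a + suc u) ≡ c + suc u
  φ-first {u} le
    rewrite ≤ᵇ-false (p<p+suc a {u}) | <ᵇ-false (≤-trans le (≤-trans j≤k (<⇒≤ k<d))) | ≤ᵇ-true le =
    ∸-from-+ j (trans (swap-summands a (suc u) d) (trans (cong (_+ suc u) a+d≡j+c) (+-assoc j c (suc u))))
    where
    swap-summands : ∀ x y z → x + y + z ≡ x + z + y
    swap-summands = solve-∀

  φ-second : ∀ {u} → j + suc u ≤ k → φ γ (j + suc u) ≡ b + suc u
  φ-second {u} le
    rewrite ≤ᵇ-false (<-trans a<j (p<p+suc j {u})) | <ᵇ-false (≤-trans le (<⇒≤ k<d))
          | ≤ᵇ-false (p<p+suc j {u}) | ≤ᵇ-true le =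
    ∸-from-+ (j + k) (trans (rearrange j (suc u) a d) (trans (cong (λ v → j + v + suc u) a+d≡k+b) (rearrange′ j k b (suc u))))
    where
    rearrange : ∀ x y z w → x + y + z + w ≡ x + (z + w) + y
    rearrange = solve-∀
    rearrange′ : ∀ x y z w → x + (y + z) + w ≡ x + y + (z + w)
    rearrange′ = solve-∀

  φ-third : ∀ {u} → k + suc u ≤ d → φ γ (k + suc u) ≡ a + suc u
  φ-third {u} le
    rewrite ≤ᵇ-false (<-trans (<-≤-trans a<j j≤k) (p<p+suc k {u})) | <ᵇ-false le
          | ≤ᵇ-false (≤-<-trans j≤k (p<p+suc k {u})) | ≤ᵇ-false (p<p+suc k {u}) =
    ∸-from-+ k (trans (+-assoc k (suc u) a) (cong (k +_) (+-comm (suc u) a)))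

  φ⁻¹-low : ∀ {x} → x ≤ a → φ⁻¹ γ x ≡ x
  φ⁻¹-low le rewrite ≤ᵇ-true le = refl

  φ⁻¹-high : ∀ {x} → d < x → φ⁻¹ γ x ≡ x
  φ⁻¹-high lt rewrite ≤ᵇ-false (a<-high lt) | <ᵇ-true lt = refl

  φ⁻¹-first : ∀ {u} → a + suc u ≤ b → φ⁻¹ γ (a + suc u) ≡ k + suc u
  φ⁻¹-first {u} le
    rewrite ≤ᵇ-false (p<p+suc a {u}) | <ᵇ-false (≤-trans le (<⇒≤ b<d))
          | a+d∸k≡b | ≤ᵇ-true le =
    ∸-from-+ a (trans (+-assoc a (suc u) k) (cong (a +_) (+-comm (suc u) k)))

  φ⁻¹-second : ∀ {u} → b + suc u ≤ c → φ⁻¹ γ (b + suc u) ≡ j + suc u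
  φ⁻¹-second {u} le
    rewrite ≤ᵇ-false (<-trans a<b (p<p+suc b {u})) | <ᵇ-false (≤-trans le (<⇒≤ c<d))
          | a+d∸k≡b | ≤ᵇ-false (p<p+suc b {u}) | a+d∸j≡c | ≤ᵇ-true le =
    ∸-from-+ (a + d) (trans (rearrange b (suc u) j k) (cong (_+ (j + suc u)) (sym a+d≡k+b)))
    where
    rearrange : ∀ x y z w → x + y + z + w ≡ w + x + (z + y)
    rearrange = solve-∀

  φ⁻¹-third : ∀ {u} → c + suc u ≤ d → φ⁻¹ γ (c + suc u) ≡ a + suc u
  φ⁻¹-third {u} le
    rewrite ≤ᵇ-false (<-trans a<c (p<p+suc c {u})) | <ᵇ-false le
          | a+d∸k≡b | ≤ᵇ-false (≤-<-trans b≤c (p<p+suc c {u}))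
          | a+d∸j≡c | ≤ᵇ-false (p<p+suc c {u}) =
    ∸-from-+ d (trans (rearrange c (suc u) a B) (cong (_+ (a + suc u)) c+B))
    where
    rearrange : ∀ x y z w → x + y + (z + w) ≡ x + w + (z + y)
    rearrange = solve-∀

  φ̂ : Perm n
  φ̂ = record
    { _·_ = φ γ
    ; inv = φ⁻¹ γ
    ; inv-left = inv-left′
    ; inv-right = inv-right′
    ; fix = λ x ¬i → case x ≤? a of λ where
        (yes le) → φ-low le
        (no nle) → φ-high (≰⇒> λ le → ¬i (≤-trans 1≤a (<⇒≤ (≰⇒> nle)) , ≤-trans le d≤n)) }
    where
    inv-left′ : ∀ x → φ⁻¹ γ (φ γ x) ≡ x
    inv-left′ x with region a j k d x
    ... | low le = trans (cong (φ⁻¹ γ) (φ-low le)) (φ⁻¹-low le)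
    ... | first le = trans (cong (φ⁻¹ γ) (φ-first le)) (φ⁻¹-third (shift B refl c+B le))
    ... | second le = trans (cong (φ⁻¹ γ) (φ-second le)) (φ⁻¹-second (shift C refl b+C le))
    ... | third le = trans (cong (φ⁻¹ γ) (φ-third le)) (φ⁻¹-first (shift D k+D a+D le))
    ... | high lt = trans (cong (φ⁻¹ γ) (φ-high lt)) (φ⁻¹-high lt)
    inv-right′ : ∀ x → φ γ (φ⁻¹ γ x) ≡ x
    inv-right′ x with region a b c d x
    ... | low le = trans (cong (φ γ) (φ⁻¹-low le)) (φ-low le)
    ... | first le = trans (cong (φ γ) (φ⁻¹-first le)) (φ-third (shift D a+D k+D le))
    ... | second le = trans (cong (φ γ) (φ⁻¹-second le)) (φ-second (shift C b+C refl le))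
    ... | third le = trans (cong (φ γ) (φ⁻¹-third le)) (φ-first (shift B c+B refl le))
    ... | high lt = trans (cong (φ γ) (φ⁻¹-high lt)) (φ-high lt)

  sucs : ∀ {p q u} → φ γ (p + suc u) ≡ q + suc u → φ γ (suc (p + u)) ≡ suc (q + u)
  sucs {p} {q} {u} = subst₂ (λ x y → φ γ x ≡ y) (+-suc p u) (+-suc q u)

  sucs₀ : ∀ {p q} → φ γ (p + 1) ≡ q + 1 → φ γ (suc p) ≡ suc q
  sucs₀ {p} {q} = subst₂ (λ x y → φ γ x ≡ y) (+-comm p 1) (+-comm q 1)

  <⇒+1≤ : ∀ {p q} → p < q → p + 1 ≤ q
  <⇒+1≤ {p} lt = ≤-trans (≤-reflexive (+-comm p 1)) lt

  φ-suc-a : φ γ (suc a) ≡ suc c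
  φ-suc-a = sucs₀ (φ-first (<⇒+1≤ a<j))

  φ-suc-j : b < c → φ γ (suc j) ≡ suc b
  φ-suc-j b<c = sucs₀ (φ-second (<⇒+1≤ (m<m+n j (m<n⇒0<n∸m b<c))))

  φ-suc-k : φ γ (suc k) ≡ suc a
  φ-suc-k = sucs₀ (φ-third (<⇒+1≤ k<d))

  τ : Perm n
  τ = swapAC ⊙ swapBD

  a<d : a < d
  a<d = <-trans a<b b<d

  τ-a : τ · a ≡ c
  τ-a = trans (cong (swap a c) (swap-other (<⇒≢ a<b) (<⇒≢ a<d))) (swap-left a c)

  τ-b : τ · b ≡ d
  τ-b = trans (cong (swap a c) (swap-left b d)) (swap-other (>⇒≢ a<d) (>⇒≢ c<d))

  τ-c : b < c → τ · c ≡ a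
  τ-c b<c = trans (cong (swap a c) (swap-other (>⇒≢ b<c) (<⇒≢ c<d))) (swap-right a c)

  τ-d-< : b < c → τ · d ≡ b
  τ-d-< b<c = trans (cong (swap a c) (swap-right b d)) (swap-other (>⇒≢ a<b) (<⇒≢ b<c))

  τ-d-≡ : b ≡ c → τ · d ≡ a
  τ-d-≡ b≡c = trans (cong (swap a c) (trans (swap-right b d) b≡c)) (swap-right a c)

  τ-other : ∀ {x} → x ≢ a → x ≢ b → x ≢ c → x ≢ d → τ · x ≡ x
  τ-other x≢a x≢b x≢c x≢d = trans (cong (swap a c) (swap-other x≢b x≢d)) (swap-other x≢a x≢c)

  module _ (1≤n : 1 ≤ n) where

    private ζ̂ = rotation 1≤n

    -- Inside a color class `τ` fixes `φ γ x` and `φ` is a translation at `x` and its successor.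
    -- Only the ends `a`, `j`, `k`, `d` need thought: there `τ` moves the end of one image arc to
    -- the label just before the start of the next.
    φ-conjugates : ∀ x → φ̂ · ζ̂ · x ≡ ζ̂ · τ · φ̂ · x
    φ-conjugates x with in? n x
    ... | no ¬i = trans (cong (φ γ) (fix ζ̂ x ¬i)) (trans (fix φ̂ x ¬i)
      (sym (trans (cong (λ v → ζ̂ · τ · v) (fix φ̂ x ¬i)) (trans (cong (ζ̂ ·_) (fix τ x ¬i)) (fix ζ̂ x ¬i)))))
    ... | yes i = inside (region a j k d x) i
      where
      φ-suc : ∀ {x y y′} → φ γ x ≡ y → τ · y ≡ y′ → 1 ≤ x → x < n → 1 ≤ y′ → y′ < n →
        φ γ (suc x) ≡ suc y′ → φ̂ · ζ̂ · x ≡ ζ̂ · τ · φ̂ · x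
      φ-suc {x} {y} {y′} φx τy 1≤x x<n 1≤y′ y′<n e = begin
        φ γ (ζ̂ · x)          ≡⟨ cong (φ γ) (rotation-suc 1≤n 1≤x x<n) ⟩
        φ γ (suc x)          ≡⟨ e ⟩
        suc y′               ≡⟨ rotation-suc 1≤n 1≤y′ y′<n ⟨
        ζ̂ · y′               ≡⟨ cong (ζ̂ ·_) (trans (cong (τ ·_) φx) τy) ⟨
        ζ̂ · τ · φ γ x        ∎
        where open ≡-Reasoning
      1≤+ : ∀ p {u} → 1 ≤ p + suc u
      1≤+ p {u} = ≤-trans (s≤s z≤n) (m≤n+m (suc u) p)
      -- This includes the wrap-around from n to 1: both `suc x` and 1 lie in the class A, where `φ`
      -- is the identity.
      φ-rotation : ∀ {x} → In n x → d ≤ x → φ γ (ζ̂ · x) ≡ ζ̂ · x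
      φ-rotation {x} (l , x≤n) d≤x with m≤n⇒m<n∨m≡n x≤n
      ... | inj₁ x<n rewrite rotation-suc 1≤n l x<n = φ-high (s≤s d≤x)
      ... | inj₂ e rewrite rotation-last 1≤n l e = φ-low 1≤a
      inside : ∀ {x} → Region a j k d x → In n x → φ̂ · ζ̂ · x ≡ ζ̂ · τ · φ̂ · x
      inside (low x≤a) (1≤x , _) with m≤n⇒m<n∨m≡n x≤a
      ... | inj₁ x<a = φ-suc (φ-low x≤a)
              (τ-other (<⇒≢ x<a) (<⇒≢ (<-trans x<a a<b)) (<⇒≢ (<-trans x<a a<c)) (<⇒≢ (<-trans x<a a<d)))
              1≤x x<n 1≤x x<n (φ-low x<a)
        where x<n = <-≤-trans x<a (In.upper inA)
      ... | inj₂ refl = φ-suc (φ-low x≤a) τ-a 1≤x (<-≤-trans a<d d≤n) (In.lower inC) (<-≤-trans c<d d≤n) φ-suc-a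
      inside (first {u} x≤j) (1≤x , x≤n) with m≤n⇒m<n∨m≡n x≤j
      ... | inj₁ x<j = φ-suc (φ-first x≤j)
              (τ-other (>⇒≢ (<-trans a<c c<y)) (>⇒≢ (≤-<-trans b≤c c<y)) (>⇒≢ c<y) (<⇒≢ y<d))
              1≤x (<-≤-trans x<j (≤-trans j≤k (≤-trans (<⇒≤ k<d) d≤n))) (1≤+ c) (<-≤-trans y<d d≤n)
              (sucs (φ-first x<j′))
        where
        x<j′ = ≤-trans (≤-reflexive (+-suc a (suc u))) x<j
        c<y : c < c + suc u
        c<y = p<p+suc c
        y<d : c + suc u < d
        y<d = ≤-trans (≤-reflexive (sym (+-suc c (suc u)))) (shift B refl c+B x<j′)
      ... | inj₂ x≡j with m≤n⇒m<n∨m≡n b≤c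
      ...   | inj₁ b<c = φ-suc φx (τ-d-< b<c) 1≤x x<n (In.lower inB) (<-≤-trans b<d d≤n)
              (trans (cong (φ γ ∘ suc) x≡j) (φ-suc-j b<c))
        where
        x<n = <-≤-trans (≤-<-trans x≤j (≤-<-trans j≤k k<d)) d≤n
        φx : φ γ (a + suc u) ≡ d
        φx = trans (φ-first x≤j) (trans (cong (c +_) (+-cancelˡ-≡ a _ _ x≡j)) c+B)
      -- The class C is empty, so the successor of `j` is already the first label of D.
      ...   | inj₂ b≡c = φ-suc φx (τ-d-≡ b≡c) 1≤x x<n 1≤a (<-≤-trans a<d d≤n)
              (trans (cong (φ γ ∘ suc) (trans x≡j j≡k)) φ-suc-k)
        where
        x<n = <-≤-trans (≤-<-trans x≤j (≤-<-trans j≤k k<d)) d≤n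
        φx : φ γ (a + suc u) ≡ d
        φx = trans (φ-first x≤j) (trans (cong (c +_) (+-cancelˡ-≡ a _ _ x≡j)) c+B)
        j≡k : j ≡ k
        j≡k = trans (sym (+-identityʳ j)) (cong (j +_) (sym (m≤n⇒m∸n≡0 (≤-reflexive (sym b≡c)))))
      inside (second {u} x≤k) (1≤x , x≤n) with m≤n⇒m<n∨m≡n x≤k
      ... | inj₁ x<k = φ-suc (φ-second x≤k)
              (τ-other (>⇒≢ (<-trans a<b b<y)) (>⇒≢ b<y) (<⇒≢ y<c) (<⇒≢ (<-trans y<c c<d)))
              1≤x (<-≤-trans x<k (≤-trans (<⇒≤ k<d) d≤n)) (1≤+ b) (<-≤-trans (<-trans y<c c<d) d≤n)
              (sucs (φ-second x<k′))
        where
        x<k′ = ≤-trans (≤-reflexive (+-suc j (suc u))) x<k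
        b<y : b < b + suc u
        b<y = p<p+suc b
        y<c : b + suc u < c
        y<c = ≤-trans (≤-reflexive (sym (+-suc b (suc u)))) (shift C refl b+C x<k′)
      ... | inj₂ x≡k = φ-suc φx (τ-c (<-≤-trans (p<p+suc b) (≤-reflexive b+u≡c))) 1≤x
              (<-≤-trans (≤-<-trans x≤k k<d) d≤n) 1≤a (<-≤-trans a<d d≤n)
              (trans (cong (φ γ ∘ suc) x≡k) φ-suc-k)
        where
        b+u≡c : b + suc u ≡ c
        b+u≡c = trans (cong (b +_) (+-cancelˡ-≡ j _ _ x≡k)) b+C
        φx : φ γ (j + suc u) ≡ c
        φx = trans (φ-second x≤k) b+u≡c
      inside (third {u} x≤d) i@(1≤x , x≤n) with m≤n⇒m<n∨m≡n x≤d
      ... | inj₁ x<d = φ-suc (φ-third x≤d)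
              (τ-other (>⇒≢ a<y) (<⇒≢ y<b) (<⇒≢ (<-≤-trans y<b b≤c)) (<⇒≢ (<-trans y<b b<d)))
              1≤x (<-≤-trans x<d d≤n) (1≤+ a) (<-≤-trans (<-trans y<b b<d) d≤n)
              (sucs (φ-third x<d′))
        where
        x<d′ = ≤-trans (≤-reflexive (+-suc k (suc u))) x<d
        a<y : a < a + suc u
        a<y = p<p+suc a
        y<b : a + suc u < b
        y<b = ≤-trans (≤-reflexive (sym (+-suc a (suc u)))) (shift D k+D a+D x<d′)
      ... | inj₂ x≡d = trans (φ-rotation i (≤-reflexive (sym x≡d)))
              (cong (ζ̂ ·_) (trans x≡d (sym (trans (cong (τ ·_) φx) τ-b))))
        where
        φx : φ γ (k + suc u) ≡ b
        φx = trans (φ-third x≤d) (trans (cong (a +_) (+-cancelˡ-≡ k _ _ (trans x≡d (sym k+D)))) a+D)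
      inside (high d<x) i = trans (φ-rotation i (<⇒≤ d<x)) (cong (ζ̂ ·_)
        (sym (trans (cong (τ ·_) (φ-high d<x))
          (τ-other (>⇒≢ (<-trans a<d d<x)) (>⇒≢ (<-trans b<d d<x)) (>⇒≢ (<-trans c<d d<x)) (>⇒≢ d<x)))))

-- The permutation of {1,…,n} underlying an element of S_n

module _ (α : Permutation′ n) where

  ⟦⟧-inside : ∀ {x} (lt : x < n) → ⟦ α ⟧ (suc x) ≡ suc (toℕ (α ⟨$⟩ʳ fromℕ< lt))
  ⟦⟧-inside {x} lt with x <? n
  ... | yes _ = refl
  ... | no nlt = contradiction lt nlt

  ⟦⟧⁻¹-inside : ∀ {x} (lt : x < n) → ⟦ α ⟧⁻¹ (suc x) ≡ suc (toℕ (α ⟨$⟩ˡ fromℕ< lt))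
  ⟦⟧⁻¹-inside {x} lt with x <? n
  ... | yes _ = refl
  ... | no nlt = contradiction lt nlt

  ⟦⟧-outside : ∀ {x} → ¬ x < n → ⟦ α ⟧ (suc x) ≡ suc x
  ⟦⟧-outside {x} nlt with x <? n
  ... | yes lt = contradiction lt nlt
  ... | no _ = refl

  ⟦⟧⁻¹-outside : ∀ {x} → ¬ x < n → ⟦ α ⟧⁻¹ (suc x) ≡ suc x
  ⟦⟧⁻¹-outside {x} nlt with x <? n
  ... | yes lt = contradiction lt nlt
  ... | no _ = refl

  -- ⟦ α ⟧ sends the out-of-range label 0 to ⟦ α ⟧ 1; here 0 is fixed instead.
  perm : Perm n
  perm = record { _·_ = to ; inv = from ; inv-left = from-to ; inv-right = to-from ; fix = fixed }
    where
    to from : ℕ → ℕ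
    to zero = zero
    to (suc x) = ⟦ α ⟧ (suc x)
    from zero = zero
    from (suc x) = ⟦ α ⟧⁻¹ (suc x)
    from-to : ∀ x → from (to x) ≡ x
    from-to zero = refl
    from-to (suc x) = case x <? n of λ where
      (no nlt) → trans (cong from (⟦⟧-outside nlt)) (⟦⟧⁻¹-outside nlt)
      (yes lt) → trans (cong from (⟦⟧-inside lt)) (trans (⟦⟧⁻¹-inside (toℕ<n _))
        (cong suc (trans (cong (toℕ ∘ (α ⟨$⟩ˡ_)) (fromℕ<-toℕ _ (toℕ<n _)))
          (trans (cong toℕ (inverseˡ α)) (toℕ-fromℕ< lt)))))
    to-from : ∀ x → to (from x) ≡ x
    to-from zero = refl
    to-from (suc x) = case x <? n of λ where
      (no nlt) → trans (cong to (⟦⟧⁻¹-outside nlt)) (⟦⟧-outside nlt)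
      (yes lt) → trans (cong to (⟦⟧⁻¹-inside lt)) (trans (⟦⟧-inside (toℕ<n _))
        (cong suc (trans (cong (toℕ ∘ (α ⟨$⟩ʳ_)) (fromℕ<-toℕ _ (toℕ<n _)))
          (trans (cong toℕ (inverseʳ α)) (toℕ-fromℕ< lt)))))
    fixed : ∀ x → ¬ In n x → to x ≡ x
    fixed zero _ = refl
    fixed (suc x) ¬i = ⟦⟧-outside (λ lt → ¬i (suc-In lt))

-- `z` looks only at labels in range and their iterates, which stay in range; the arbitrary values
-- elsewhere in the statement's maps are therefore invisible to it.
z-cong : (f : ℕ → ℕ) (g : Perm n) → (∀ {x} → In n x → f x ≡ g · x) → z n f ≡ cycles g
z-cong {n} f g e = trans (sum-indicator (isCycleMin n f) id n)
  (trans (count-cong n λ u lt → cong and (map-cong (λ k → cong (suc u ≤ᵇ_) (iter≡ k (suc-In lt))) (upTo n)))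
    (sym (cycles≡count g)))
  where
  iter≡ : ∀ k {x} → In n x → iter f k x ≡ iter (g ·_) k x
  iter≡ zero i = refl
  iter≡ (suc k) i = trans (cong f (iter≡ k i)) (e (iter-In {f = g} k i))

ζ≡rotation : (1≤n : 1 ≤ n) → ∀ {x} → In n x → ζ n x ≡ rotation 1≤n · x
ζ≡rotation {n} 1≤n {x} (l , x≤n) with m≤n⇒m<n∨m≡n x≤n
... | inj₁ x<n rewrite <ᵇ-true x<n = sym (rotation-suc 1≤n l x<n)
... | inj₂ x≡n rewrite <ᵇ-false (≤-reflexive (sym x≡n)) = sym (rotation-last 1≤n l x≡n)

-- Recoloring a permutation of genus one

conjugate-uncrossed : (1≤n : 1 ≤ n) (f g h τ : Perm n) → (∀ u → f · g · u ≡ rotation 1≤n · u) →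
  (∀ u → h · rotation 1≤n · u ≡ rotation 1≤n · τ · h · u) →
  cycles f + cycles (τ ⊙ g) ≡ n + 1 → ¬ Crossing (inverse h ⊙ f ⊙ h)
conjugate-uncrossed {n} 1≤n f g h τ fg≡ζ hζ≡ζτh genus-0 = genus-0-uncrossed 1≤n f′ g′ f′g′≡ζ
  (trans (cong₂ _+_
    (cycles-conjugate f′ f h (λ x → inv-right h (f · h · x)))
    -- Conjugating by `τ ⊙ h` instead of `h` moves `τ` from behind `g` to the front, the side on
    -- which `cycles-crossing` counts.
    (cycles-conjugate g′ (τ ⊙ g) (τ ⊙ h) (λ x → cong (τ ·_) (inv-right h (g · τ · h · x)))))
  genus-0)
  where
  open ≡-Reasoning
  ζ̂ f′ g′ : Perm n
  ζ̂ = rotation 1≤n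
  f′ = inverse h ⊙ f ⊙ h
  g′ = inverse h ⊙ g ⊙ τ ⊙ h

  f′g′≡ζ : ∀ u → f′ · g′ · u ≡ ζ̂ · u
  f′g′≡ζ u = begin
    inv h (f · h · inv h (g · τ · h · u))  ≡⟨ cong (λ v → inv h (f · v)) (inv-right h (g · τ · h · u)) ⟩
    inv h (f · g · τ · h · u)              ≡⟨ cong (inv h) (fg≡ζ (τ · h · u)) ⟩
    inv h (ζ̂ · τ · h · u)                  ≡⟨ cong (inv h) (hζ≡ζτh u) ⟨
    inv h (h · ζ̂ · u)                      ≡⟨ inv-left h (ζ̂ · u) ⟩
    ζ̂ · u                                  ∎

genus-1-recoloring : (1≤n : 1 ≤ n) (f g : Perm n) → (∀ u → f · g · u ≡ rotation 1≤n · u) →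
  n + 1 ≡ 2 + (cycles f + cycles g) →
  Σ (ℕ → ℕ) λ b → NonCrossing n b × Σ (FourColoring n) λ γ → ∀ {x} → In n x → f · x ≡ Φ n b γ x
genus-1-recoloring {n} 1≤n f g fg≡ζ genus with genus-0-or-crossing 1≤n f g fg≡ζ
-- Genus 0 would turn the hypothesis into n + 1 = n + 3.
... | inj₁ e = contradiction (trans genus (cong (2 +_) e)) (<⇒≢ (s≤s (n≤1+n _)))
... | inj₂ X = block f′ , uncrossed⇒noncrossing f′ uncrossed , γ , λ {x} i → begin
      f · x                                  ≡⟨ cong (f ·_) (inv-right φ̂ x) ⟨
      f · φ̂ · φ⁻¹ γ x                        ≡⟨ inv-right φ̂ _ ⟨
      φ̂ · f′ · φ⁻¹ γ x                       ≡⟨ cong (φ γ) (uncrossed⇒β f′ uncrossed (·-In (inverse φ̂) i)) ⟨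
      Φ n (block f′) γ x                     ∎
  where
  open ≡-Reasoning
  open Recoloring (Crossing.cuts X)
  f′ : Perm n
  f′ = inverse φ̂ ⊙ f ⊙ φ̂

  uncrossed : ¬ Crossing f′
  uncrossed = conjugate-uncrossed 1≤n f g φ̂ τ fg≡ζ (φ-conjugates 1≤n) (begin
    cycles f + cycles (τ ⊙ g)              ≡⟨ cong (cycles f +_) (cycles-crossing X) ⟩
    cycles f + (2 + cycles g)              ≡⟨ rearrange (cycles f) (cycles g) ⟩
    2 + (cycles f + cycles g)              ≡⟨ genus ⟨
    n + 1                                  ∎)
    where
    rearrange : ∀ x y → x + (2 + y) ≡ 2 + (x + y)
    rearrange = solve-∀

-- For n = 0 both cycle counts vanish and the genus equation reads 1 ≡ 2.
HasGenus⇒1≤n : ∀ n (α : Permutation′ n) → HasGenus n α 1 → 1 ≤ n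
HasGenus⇒1≤n (suc n) _ _ = s≤s z≤n

theorem2p8 : (n : ℕ) (α : Permutation′ n) → HasGenus n α 1 →
    Σ (ℕ → ℕ) λ b → NonCrossing n b × Σ (FourColoring n) λ γ →
    ∀ x → 1 ≤ x → x ≤ n → ⟦ α ⟧ x ≡ Φ n b γ x
theorem2p8 n α genus =
  let b , noncrossing , γ , α≡Φ = genus-1-recoloring 1≤n f g (λ u → inv-right f (ζ̂ · u)) genus′
  in b , noncrossing , γ , λ x 1≤x x≤n → trans (⟦α⟧ (1≤x , x≤n)) (α≡Φ (1≤x , x≤n))
  where
  1≤n : 1 ≤ n
  1≤n = HasGenus⇒1≤n n α genus
  ζ̂ f g : Perm n
  ζ̂ = rotation 1≤n
  f = perm α
  g = inverse f ⊙ ζ̂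

  ⟦α⟧ : ∀ {x} → In n x → ⟦ α ⟧ x ≡ f · x
  ⟦α⟧ {suc x} _ = refl

  ⟦α⟧⁻¹∘ζ : ∀ {x} → In n x → ⟦ α ⟧⁻¹ (ζ n x) ≡ g · x
  -- Matching on `suc y` exposes that `ζ̂ · x` is not 0, the label at which `inv f` is defined
  -- separately.
  ⟦α⟧⁻¹∘ζ {x} i rewrite ζ≡rotation 1≤n i with ζ̂ · x | ·-In ζ̂ i
  ... | suc y | _ = refl

  genus′ : n + 1 ≡ 2 + (cycles f + cycles g)
  genus′ = trans genus (cong (2 +_) (cong₂ _+_ (z-cong ⟦ α ⟧ f ⟦α⟧) (z-cong (⟦ α ⟧⁻¹ ∘′ ζ n) g ⟦α⟧⁻¹∘ζ)))
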